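{- Let $G$ be a finite simple graph that is $\delta$-dense. If $G$ and $G^2$ have nested solutions, then $G^d$ has nested solutions for every integer $d\geq 3$.
   Context: All graphs are finite and simple. For a graph $G=(V,E)$ and $A\subseteq V$, let $I_G(A)$ be the set of edges of $G$ with both endpoints in $A$, and for $0\le m\le |V|$ let $I_G(m)=\max_{A\subseteq V,\,|A|=m}|I_G(A)|$ (so $I_G(0)=0$). A set $A$ with $|A|=m$ and $|I_G(A)|=I_G(m)$ is called optimal. $G$ has nested solutions (NS) if there are sets $A_1\subseteq A_2\subseteq\cdots\subseteq A_{|V|}$ with $|A_i|=i$ and each $A_i$ optimal. The $\delta$-sequence of $G$ is $\delta_G=(\delta_G(1),\dots,\delta_G(|V|))$ where $\delta_G(m)=I_G(m)-I_G(m-1)$. Partition $\delta_G$ into consecutive maximal strictly increasing runs ("monotonic segments"); let $r$ be the number of segments, let $M_{G,i}$ be the set of positions in the $i$-th segment, and let $s_{G,i}=\delta_G\bigl(1+\sum_{k=1}^{i-1}|M_{G,k}|\bigr)$ be the first value of the $i$-th segment. $G$ is called $\delta$-dense iff $s_{G,2},\dots,s_{G,r}>1$ (i.e. every segment other than the first starts with a value at least $2$). The Cartesian product $H\square G$ has vertex set $V_H\times V_G$, with $(x,y)$ adjacent to $(u,v)$ iff either $x=u$ and $\{y,v\}\in E_G$, or $\{x,u\}\in E_H$ and $y=v$. $G^d$ denotes the $d$-fold Cartesian power $G\square\cdots\square G$. -}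

module Defs where

open import Data.Nat using (ℕ; zero; suc; _+_; _*_; _∸_; _≤_; _⊔_)
open import Data.Bool using (Bool; true; false; _∧_; _∨_; if_then_else_)
open import Data.Fin using (Fin; toℕ; remQuot)
open import Data.Fin.Properties using () renaming (_≟_ to _≟ᶠ_)
open import Data.Fin.Subset using (Subset; ∣_∣; _⊆_; ⊥)
open import Data.Vec using (Vec; []; _∷_; lookup)
open import Data.List using (List; []; _∷_; map; filter; foldr; allFin; concatMap; _++_)
open import Data.Nat.ListAction using (sum)
open import Data.Nat.Properties using (_<?_; _≟_)
open import Data.Product using (_×_; _,_; Σ; ∃)
open import Relation.Nullary.Decidable using (⌊_⌋)
open import Relation.Binary.PropositionalEquality using (_≡_)

record Graph : Set where
  field
    n   : ℕ
    adj : Fin n → Fin n → Bool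
open Graph public

Simple : Graph → Set
Simple G = (∀ i j → adj G i j ≡ adj G j i) × (∀ i → adj G i i ≡ false)

edgesIn : (G : Graph) → Subset (n G) → ℕ
edgesIn G A =
  sum (concatMap (λ i → map (λ j →
         if ⌊ toℕ i <? toℕ j ⌋ ∧ lookup A i ∧ lookup A j ∧ adj G i j then 1 else 0)
       (allFin (n G))) (allFin (n G)))

allSubsets : ∀ k → List (Subset k)
allSubsets zero    = [] ∷ []
allSubsets (suc k) = map (true ∷_) (allSubsets k) ++ map (false ∷_) (allSubsets k)

I : (G : Graph) → ℕ → ℕ
I G m = foldr _⊔_ 0 (map (edgesIn G) (filter (λ A → ∣ A ∣ ≟ m) (allSubsets (n G))))

Optimal : (G : Graph) → ℕ → Subset (n G) → Set
Optimal G m A = (∣ A ∣ ≡ m) × (edgesIn G A ≡ I G m)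

-- Nested solutions: A_0 ⊆ A_1 ⊆ ... ⊆ A_{|V|}, each A_i optimal of size i.
-- (A_0 is necessarily the empty set; including it is harmless.)
NestedSolutions : Graph → Set
NestedSolutions G =
  Σ (ℕ → Subset (n G)) λ A →
    (∀ i → i ≤ n G → Optimal G i (A i)) ×
    (∀ i → suc i ≤ n G → A i ⊆ A (suc i))

-- δ_G(m) = I_G(m) - I_G(m-1)  (I_G is nondecreasing, so truncated subtraction is exact).
δ : Graph → ℕ → ℕ
δ G m = I G m ∸ I G (m ∸ 1)

-- Partitioning (δ(1),...,δ(|V|)) into maximal strictly increasing runs, a new
-- segment (other than the first) starts exactly at the positions m with
-- 2 ≤ m ≤ |V| and δ(m) ≤ δ(m-1).  δ-dense: every such segment start has value ≥ 2.
DeltaDense : Graph → Set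
DeltaDense G = ∀ m → 2 ≤ m → m ≤ n G → δ G m ≤ δ G (m ∸ 1) → 2 ≤ δ G m

_□_ : Graph → Graph → Graph
H □ G = record
  { n   = n H * n G
  ; adj = λ a b → go (remQuot {n H} (n G) a) (remQuot {n H} (n G) b)
  }
  where
  go : Fin (n H) × Fin (n G) → Fin (n H) × Fin (n G) → Bool
  go (x , y) (u , v) = (⌊ x ≟ᶠ u ⌋ ∧ adj G y v) ∨ (adj H x u ∧ ⌊ y ≟ᶠ v ⌋)

K₁ : Graph
K₁ = record { n = 1 ; adj = λ _ _ → false }

_^□_ : Graph → ℕ → Graph
G ^□ zero          = K₁
G ^□ suc zero      = G
G ^□ suc (suc d)   = (G ^□ suc d) □ G

{-# OPTIONS --safe #-}
-- Write p = |V| and δ_i = δ_G(i + 1).  Compressing a subset of H □ G first inside the copies of H and then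
-- across them turns it into an antitone function f : [p] → [0 .. |H|] with at least as many edges, namely
-- Σ_a I_H(f a) + δ_a f(a); conversely every antitone f is realised by a set with exactly that many edges.
--
-- For a δ-dense G the nested solutions of G² are forced to be lexicographic, up to transposition.  With a full
-- columns and b ≥ 1 cells in column a, opening column a + 1 gains δ_{a+1} ≤ δ_a + 1 while continuing gains
-- δ_a + δ_b, so b = 1.  After that, growing column a always falls behind the lexicographic set, because
-- I(a + j) ≤ I(a) + j δ_a + I(j) and δ_j ≥ 2 for j ≥ 2; but the columns to its right run out of room.
--
-- Lexicographic optimality passes from G² and G^(d-1) to G^d.  View [p]^d as a p × p grid of boxes, each a copy
-- of G^(d-2) filled lexicographically.  Alternately refill every column (optimality in G^(d-1)) and sort the box
-- contents along the lexicographic order of the grid (optimality in G², applied to the level sets).  Each round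
-- lowers the number of partially filled boxes as long as two of them share a column.  Otherwise at most two are
-- left, the last of one column and the first of the next, and merging them does not lose edges.
module Submission where

open import Defs renaming (n to order; δ to δᴳ)
open import Data.Bool using (Bool; true; false; _∧_; _∨_; not; if_then_else_)
open import Data.Bool.Properties using (∧-zeroʳ; ∨-identityʳ)
open import Data.Empty using (⊥)
open import Data.Fin using (Fin; zero; suc; toℕ; combine; remQuot; fromℕ<; _↑ˡ_; _↑ʳ_)
open import Data.Fin.Properties using (toℕ<n; toℕ-fromℕ<; toℕ-injective; remQuot-combine) renaming (_≟_ to _≟ᶠ_)
open import Data.Fin.Subset using (Subset; ∣_∣; _⊆_)
open import Data.List as List using (List; []; _∷_; map; concatMap; allFin; foldr; filter)
open import Data.List.Membership.Propositional using (_∈_)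
open import Data.List.Membership.Propositional.Properties using (∈-map⁺; ∈-++⁺ˡ; ∈-++⁺ʳ; ∈-filter⁺; ∈-filter⁻)
open import Data.List.Properties using (map-tabulate)
open import Data.List.Relation.Unary.Any using (here; there)
open import Data.Nat using (ℕ; zero; suc; _+_; _*_; _∸_; _⊓_; _⊔_; _≤_; _<_; _<ᵇ_; _≡ᵇ_; z≤n; s≤s; s≤s⁻¹; NonZero; >-nonZero; _/_; _%_)
open import Data.Nat.DivMod using (m%n<n; m≡m%n+[m/n]*n; +-distrib-/-∣ˡ; m*n/n≡m; m<n⇒m/n≡0; [m+kn]%n≡m%n; m<n⇒m%n≡m; m<n*o⇒m/o<n)
open import Data.Nat.Divisibility using (n∣m*n)
open import Data.Nat.ListAction using () renaming (sum to sumᴸ)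
open import Data.Nat.ListAction.Properties using (sum-++)
open import Data.Nat.Properties
open import Data.Nat.Tactic.RingSolver using (solve-∀)
open import Data.Product using (_×_; _,_; proj₁; proj₂; ∃)
open import Data.Sum using (_⊎_; inj₁; inj₂)
open import Data.Vec using (lookup; tabulate; []; _∷_)
open import Data.Vec.Properties using (lookup∘tabulate; lookup⇒[]=; []=⇒lookup)
open import Function using (_∘_; id)
open import Relation.Binary.PropositionalEquality hiding (J)
open import Relation.Nullary using (contradiction; yes; no)
open import Relation.Nullary.Decidable using (⌊_⌋)
open import Algebra.Properties.Semiring.Sum +-*-semiring

-- Finite sums

sum-mono : ∀ {n} {f g : Fin n → ℕ} → (∀ i → f i ≤ g i) → sum f ≤ sum g
sum-mono {zero}  f≤g = z≤n
sum-mono {suc n} f≤g = +-mono-≤ (f≤g zero) (sum-mono (f≤g ∘ suc))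

sum-mono-< : ∀ {n} {f g : Fin n → ℕ} → (∀ i → f i ≤ g i) → ∀ k → f k < g k → sum f < sum g
sum-mono-< f≤g zero    lt = +-mono-<-≤ lt (sum-mono (f≤g ∘ suc))
sum-mono-< f≤g (suc k) lt = +-mono-≤-< (f≤g zero) (sum-mono-< (f≤g ∘ suc) k lt)

sum-tight : ∀ {n} {f g : Fin n → ℕ} → (∀ i → f i ≤ g i) → sum f ≡ sum g → ∀ i → f i ≡ g i
sum-tight f≤g eq i with m≤n⇒m<n∨m≡n (f≤g i)
... | inj₁ lt = contradiction eq (<⇒≢ (sum-mono-< f≤g i lt))
... | inj₂ e  = e

sum-const : ∀ n c → ∑[ i < n ] c ≡ n * c
sum-const zero    c = refl
sum-const (suc n) c = cong (c +_) (sum-const n c)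

sum-zero : ∀ {n} {f : Fin n → ℕ} → (∀ i → f i ≡ 0) → sum f ≡ 0
sum-zero {n} f≡0 = trans (sum-cong-≗ f≡0) (sum-replicate-zero n)

sum≤*  : ∀ {n N} {f : Fin n → ℕ} → (∀ i → f i ≤ N) → sum f ≤ n * N
sum≤* {n} {N} f≤N = ≤-trans (sum-mono f≤N) (≤-reflexive (sum-const n N))

term≤sum : ∀ {n} (f : Fin n → ℕ) → ∀ i → f i ≤ sum f
term≤sum f zero    = m≤m+n _ _
term≤sum f (suc i) = ≤-trans (term≤sum (f ∘ suc) i) (m≤n+m _ _)

sum-split : ∀ {n} m (f : Fin (m + n) → ℕ) → sum f ≡ sum (λ i → f (i ↑ˡ n)) + sum (λ i → f (m ↑ʳ i))
sum-split zero    f = refl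
sum-split (suc m) f = trans (cong (f zero +_) (sum-split m (f ∘ suc))) (sym (+-assoc (f zero) _ _))

sum-combine : ∀ m n (f : Fin (m * n) → ℕ) → sum f ≡ ∑[ i < m ] ∑[ j < n ] f (combine i j)
sum-combine zero    n f = refl
sum-combine (suc m) n f =
  trans (sum-split n f) (cong (sum (λ i → f (i ↑ˡ (m * n))) +_) (sum-combine m n (λ i → f (n ↑ʳ i))))

-- Sequences live on all of ℕ and are summed over an initial segment, so that shifting and splitting
-- the range need no conversion between `Fin` types.
S : ℕ → (ℕ → ℕ) → ℕ
S n f = ∑[ i < n ] f (toℕ i)

S-cong : ∀ {n} {f g : ℕ → ℕ} → (∀ i → i < n → f i ≡ g i) → S n f ≡ S n g
S-cong {n} e = sum-cong-≗ {n} (λ i → e (toℕ i) (toℕ<n i))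

S-mono : ∀ {n} {f g : ℕ → ℕ} → (∀ i → i < n → f i ≤ g i) → S n f ≤ S n g
S-mono {n} e = sum-mono {n} (λ i → e (toℕ i) (toℕ<n i))

S-term : ∀ {n} (f : ℕ → ℕ) {i} → i < n → f i ≤ S n f
S-term f {i} i<n = subst (λ k → f k ≤ _) (toℕ-fromℕ< i<n) (term≤sum (f ∘ toℕ) (fromℕ< i<n))

S-tight : ∀ {n} {f g : ℕ → ℕ} → (∀ i → f i ≤ g i) → S n f ≡ S n g → ∀ {i} → i < n → f i ≡ g i
S-tight {f = f} {g} f≤g eq i<n =
  subst (λ k → f k ≡ g k) (toℕ-fromℕ< i<n) (sum-tight (f≤g ∘ toℕ) eq (fromℕ< i<n))

S≡0 : ∀ {n} (f : ℕ → ℕ) → S n f ≡ 0 → ∀ {i} → i < n → f i ≡ 0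
S≡0 f eq i<n = n≤0⇒n≡0 (≤-trans (S-term f i<n) (≤-reflexive eq))

S-zero : ∀ {n} {f : ℕ → ℕ} → (∀ i → i < n → f i ≡ 0) → S n f ≡ 0
S-zero {n} e = sum-zero {n} (λ i → e (toℕ i) (toℕ<n i))

S-split : ∀ m n (f : ℕ → ℕ) → S (m + n) f ≡ S m f + S n (λ i → f (m + i))
S-split zero    n f = refl
S-split (suc m) n f = trans (cong (f 0 +_) (S-split m n (f ∘ suc))) (sym (+-assoc (f 0) _ _))

S-last : ∀ n (f : ℕ → ℕ) → S (suc n) f ≡ S n f + f n
S-last zero    f = +-comm (f 0) 0
S-last (suc n) f = trans (cong (f 0 +_) (S-last n (f ∘ suc))) (sym (+-assoc (f 0) _ _))

S-block : ∀ m n (f : ℕ → ℕ) → S (m * n) f ≡ S m (λ a → S n (λ i → f (a * n + i)))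
S-block zero    n f = refl
S-block (suc m) n f = trans (S-split n (m * n) f)
  (cong (S n f +_) (trans (S-block m n (λ i → f (n + i)))
    (S-cong {m} λ a _ → S-cong {n} λ i _ → cong f (sym (+-assoc n (a * n) i)))))

-- Indicators with values in ℕ

⟦_⟧ : Bool → ℕ
⟦ true  ⟧ = 1
⟦ false ⟧ = 0

⟦⟧≤1 : ∀ b → ⟦ b ⟧ ≤ 1
⟦⟧≤1 true  = ≤-refl
⟦⟧≤1 false = z≤n

lt : ℕ → ℕ → ℕ
lt i j = ⟦ i <ᵇ j ⟧

lt≤1 : ∀ i j → lt i j ≤ 1
lt≤1 i j = ⟦⟧≤1 (i <ᵇ j)

lt≡1 : ∀ {i j} → i < j → lt i j ≡ 1
lt≡1 {zero}  {suc j} _         = refl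
lt≡1 {suc i} {suc j} (s≤s i<j) = lt≡1 i<j

lt≡0 : ∀ {i j} → j ≤ i → lt i j ≡ 0
lt≡0 {i}     {zero}  _         = refl
lt≡0 {suc i} {suc j} (s≤s j≤i) = lt≡0 j≤i

lt-monoʳ : ∀ i {j k} → j ≤ k → lt i j ≤ lt i k
lt-monoʳ i       {zero}          _         = z≤n
lt-monoʳ zero    {suc j} {suc k} _         = ≤-refl
lt-monoʳ (suc i) {suc j} {suc k} (s≤s j≤k) = lt-monoʳ i j≤k

lt-antiˡ : ∀ {i j} k → i ≤ j → lt j k ≤ lt i k
lt-antiˡ zero    _                   = z≤n
lt-antiˡ {zero}  {j} (suc k) _       = lt≤1 j (suc k)
lt-antiˡ {suc i} {suc j} (suc k) (s≤s i≤j) = lt-antiˡ k i≤j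

lt-0 : ∀ {x} → x ≤ 1 → lt 0 x ≡ x
lt-0 z≤n       = refl
lt-0 (s≤s z≤n) = refl

S-lt : ∀ n {k} → k ≤ n → S n (λ i → lt i k) ≡ k
S-lt n       z≤n     = S-zero {n} (λ _ _ → refl)
S-lt (suc n) (s≤s k≤n) = cong suc (S-lt n k≤n)

S-*lt : ∀ n (f : ℕ → ℕ) {k} → k ≤ n → S n (λ i → f i * lt i k) ≡ S k f
S-*lt n       f z≤n       = S-zero {n} (λ i _ → *-zeroʳ (f i))
S-*lt (suc n) f (s≤s k≤n) = cong₂ _+_ (*-identityʳ (f 0)) (S-*lt n (f ∘ suc) k≤n)

-- Antitone sequences, conjugation and sorting

Antitone : (ℕ → ℕ) → Set
Antitone f = ∀ {i j} → i ≤ j → f j ≤ f i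

-- Such a sequence is a block of ones followed by zeros, so its sum is the length of the block and
-- determines it.
lt-count : ∀ n {t} → Antitone t → (∀ i → t i ≤ 1) → ∀ {i} → i < n → lt i (S n t) ≡ t i
lt-count (suc n) {t} anti t≤1 {i} i<n with t 0 in eq
... | 0 = trans (cong (lt i) (S-zero {n} (λ j _ → t≡0 (suc j)))) (sym (t≡0 i))
  where
  t≡0 : ∀ j → t j ≡ 0
  t≡0 j = n≤0⇒n≡0 (≤-trans (anti z≤n) (≤-reflexive eq))
... | suc (suc _) = contradiction (≤-trans (≤-reflexive (sym eq)) (t≤1 0)) λ { (s≤s ()) }
lt-count (suc n) anti t≤1 {zero}  _         | 1 = sym eq
lt-count (suc n) anti t≤1 {suc i} (s≤s i<n) | 1 = lt-count n (anti ∘ s≤s) (t≤1 ∘ suc) i<n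

-- The conjugate of u, read as a partition.
τ : ∀ {n} → (Fin n → ℕ) → ℕ → ℕ
τ {n} u h = ∑[ c < n ] lt h (u c)

τ-antitone : ∀ {n} (u : Fin n → ℕ) → Antitone (τ u)
τ-antitone u i≤j = sum-mono (λ c → lt-antiˡ (u c) i≤j)

τ-mono : ∀ {n} {u v : Fin n → ℕ} → (∀ c → u c ≤ v c) → ∀ h → τ u h ≤ τ v h
τ-mono u≤v h = sum-mono (λ c → lt-monoʳ h (u≤v c))

τ≤ : ∀ {n} (u : Fin n → ℕ) → ∀ h → τ u h ≤ n
τ≤ {n} u h = ≤-trans (sum≤* (λ c → lt≤1 h (u c))) (≤-reflexive (*-identityʳ n))

τ≡0 : ∀ {n N} {u : Fin n → ℕ} → (∀ c → u c ≤ N) → ∀ {h} → N ≤ h → τ u h ≡ 0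
τ≡0 u≤N N≤h = sum-zero (λ c → lt≡0 (≤-trans (u≤N c) N≤h))

lt-τ : ∀ {n} {f} → Antitone f → ∀ h {i} → i < n → lt i (τ {n} (f ∘ toℕ) h) ≡ lt h (f i)
lt-τ {n} {f} anti h = lt-count n (λ i≤j → lt-monoʳ h (anti i≤j)) (λ i → lt≤1 h (f i))

-- Layer-cake summation: both sides add `w h` over the pairs `(h , c)` with `h < u c`. With `w = δ`
-- the right side becomes a sum of edge counts `J (u c)`.
S-τ : ∀ {n N} {u : Fin n → ℕ} → (∀ c → u c ≤ N) → (w : ℕ → ℕ) →
      S N (λ h → w h * τ u h) ≡ ∑[ c < n ] S (u c) w
S-τ {n} {N} {u} u≤N w = begin
  S N (λ h → w h * τ u h)                         ≡⟨ sum-cong-≗ {N} (λ h → *-distribˡ-sum {n} (w (toℕ h)) (λ c → lt (toℕ h) (u c))) ⟩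
  ∑[ h < N ] ∑[ c < n ] (w (toℕ h) * lt (toℕ h) (u c)) ≡⟨ ∑-comm {N} {n} (λ h c → w (toℕ h) * lt (toℕ h) (u c)) ⟩
  ∑[ c < n ] S N (λ h → w h * lt h (u c))         ≡⟨ sum-cong-≗ {n} (λ c → S-*lt N w (u≤N c)) ⟩
  ∑[ c < n ] S (u c) w                            ∎
  where open ≡-Reasoning

S-ones : ∀ n → S n (λ _ → 1) ≡ n
S-ones n = trans (sum-const n 1) (*-identityʳ n)

sum-τ : ∀ {n N} {u : Fin n → ℕ} → (∀ c → u c ≤ N) → S N (τ u) ≡ sum u
sum-τ {n} {N} {u} u≤N = begin
  S N (τ u)               ≡⟨ S-cong {N} (λ h _ → sym (*-identityˡ (τ u h))) ⟩
  S N (λ h → 1 * τ u h)   ≡⟨ S-τ u≤N (λ _ → 1) ⟩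
  ∑[ c < n ] S (u c) (λ _ → 1) ≡⟨ sum-cong-≗ {n} (λ c → S-ones (u c)) ⟩
  sum u                   ∎
  where open ≡-Reasoning

-- Conjugating twice gives the decreasing rearrangement. The first conjugate is read at `N` levels
-- only, which loses nothing when all entries are at most `N`.
srt : ∀ {n} → ℕ → (Fin n → ℕ) → ℕ → ℕ
srt N u = τ {N} (τ u ∘ toℕ)

srt≤ : ∀ {n} N (u : Fin n → ℕ) c → srt N u c ≤ N
srt≤ N u c = τ≤ {N} (τ u ∘ toℕ) c

srt-antitone : ∀ {n} N (u : Fin n → ℕ) → Antitone (srt N u)
srt-antitone N u = τ-antitone {N} (τ u ∘ toℕ)

srt≡0 : ∀ {n} N (u : Fin n → ℕ) {c} → n ≤ c → srt N u c ≡ 0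
srt≡0 N u n≤c = τ≡0 {N} (λ h → τ≤ u (toℕ h)) n≤c

S-srt : ∀ {n N} {u : Fin n → ℕ} → (∀ c → u c ≤ N) → S n (srt N u) ≡ sum u
S-srt {n} {N} {u} u≤N = trans (sum-τ {N} (λ h → τ≤ u (toℕ h))) (sum-τ u≤N)

τ-srt : ∀ {n N} {u : Fin n → ℕ} → (∀ c → u c ≤ N) → ∀ h → τ {n} (srt N u ∘ toℕ) h ≡ τ u h
τ-srt {n} {N} {u} u≤N h with h <? N
... | no h≮N = trans (τ≡0 {n} (λ c → srt≤ N u (toℕ c)) (≮⇒≥ h≮N)) (sym (τ≡0 u≤N (≮⇒≥ h≮N)))
... | yes h<N = trans (S-cong {n} (λ c _ → lt-τ {N} {τ u} (τ-antitone u) c h<N)) (S-lt n (τ≤ u h))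

private
  equal : ℕ → ℕ → ℕ
  equal k x = ⟦ k ≡ᵇ x ⟧

  eq-lt : ∀ k x → equal k x + lt k x ≡ lt k (suc x)
  eq-lt zero    zero    = refl
  eq-lt zero    (suc x) = refl
  eq-lt (suc k) zero    = refl
  eq-lt (suc k) (suc x) = eq-lt k x

  S-eq : ∀ {n} (Φ : ℕ → ℕ) {x} → x < n → S n (λ k → Φ k * equal k x) ≡ Φ x
  S-eq {suc n} Φ {zero}  _         =
    trans (cong₂ _+_ (*-identityʳ (Φ 0)) (S-zero {n} (λ i _ → *-zeroʳ (Φ (suc i))))) (+-identityʳ (Φ 0))
  S-eq {suc n} Φ {suc x} (s≤s x<n) = cong₂ _+_ (*-zeroʳ (Φ 0)) (S-eq (Φ ∘ suc) x<n)

  sum-suc : ∀ {n} (u : Fin n → ℕ) → ∀ k → ∑[ c < n ] equal k (u c) + τ u k ≡ ∑[ c < n ] lt k (suc (u c))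
  sum-suc {n} u k = trans (sym (∑-distrib-+ {n} _ _)) (sum-cong-≗ {n} (λ c → eq-lt k (u c)))

  sum-eq : ∀ {n} {u v : Fin n → ℕ} → (∀ h → τ u h ≡ τ v h) → ∀ k →
           ∑[ c < n ] equal k (u c) ≡ ∑[ c < n ] equal k (v c)
  sum-eq {n} {u} {v} same k = +-cancelʳ-≡ (τ u k) _ _ (begin
    ∑[ c < n ] equal k (u c) + τ u k  ≡⟨ sum-suc u k ⟩
    ∑[ c < n ] lt k (suc (u c))    ≡⟨ shifted k ⟩
    ∑[ c < n ] lt k (suc (v c))    ≡⟨ sum-suc v k ⟨
    ∑[ c < n ] equal k (v c) + τ v k  ≡⟨ cong (_ +_) (same k) ⟨
    ∑[ c < n ] equal k (v c) + τ u k  ∎)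
    where
    open ≡-Reasoning
    shifted : ∀ k → ∑[ c < n ] lt k (suc (u c)) ≡ ∑[ c < n ] lt k (suc (v c))
    shifted zero    = refl
    shifted (suc k) = same k

-- Level counts determine multiplicities: the number of entries equal to `k` is the number of
-- entries at least `k` minus `τ u k`. This replaces an explicit permutation between `u` and `v`.
equidistributed : ∀ {n N} {u v : Fin n → ℕ} → (∀ c → u c ≤ N) → (∀ c → v c ≤ N) →
  (∀ h → τ u h ≡ τ v h) → (Φ : ℕ → ℕ) → ∑[ c < n ] Φ (u c) ≡ ∑[ c < n ] Φ (v c)
equidistributed {n} {N} {u} {v} u≤N v≤N same Φ = begin
  ∑[ c < n ] Φ (u c)                            ≡⟨ expand u≤N ⟩
  S (suc N) (λ k → Φ k * ∑[ c < n ] equal k (u c)) ≡⟨ S-cong {suc N} (λ k _ → cong (Φ k *_) (sum-eq {u = u} {v} same k)) ⟩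
  S (suc N) (λ k → Φ k * ∑[ c < n ] equal k (v c)) ≡⟨ expand v≤N ⟨
  ∑[ c < n ] Φ (v c)                            ∎
  where
  open ≡-Reasoning
  expand : {x : Fin n → ℕ} → (∀ c → x c ≤ N) →
           ∑[ c < n ] Φ (x c) ≡ S (suc N) (λ k → Φ k * ∑[ c < n ] equal k (x c))
  expand {x} x≤N = begin
    ∑[ c < n ] Φ (x c)                               ≡⟨ sum-cong-≗ {n} (λ c → sym (S-eq {suc N} Φ (s≤s (x≤N c)))) ⟩
    ∑[ c < n ] S (suc N) (λ k → Φ k * equal k (x c))    ≡⟨ ∑-comm {n} {suc N} (λ c k → Φ (toℕ k) * equal (toℕ k) (x c)) ⟩
    ∑[ k < suc N ] ∑[ c < n ] (Φ (toℕ k) * equal (toℕ k) (x c)) ≡⟨ sum-cong-≗ {suc N} (λ k → sym (*-distribˡ-sum {n} (Φ (toℕ k)) (λ c → equal (toℕ k) (x c)))) ⟩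
    S (suc N) (λ k → Φ k * ∑[ c < n ] equal k (x c))    ∎

sum-srt : ∀ {n N} {u : Fin n → ℕ} → (∀ c → u c ≤ N) → (Φ : ℕ → ℕ) → S n (Φ ∘ srt N u) ≡ sum (Φ ∘ u)
sum-srt {N = N} {u} u≤N = equidistributed (λ c → srt≤ N u (toℕ c)) u≤N (τ-srt u≤N)

-- Lexicographic filling

-- fill N m lists how m units fill up consecutive boxes of capacity N.
fill : ℕ → ℕ → ℕ → ℕ
fill N m zero    = N ⊓ m
fill N m (suc a) = fill N (m ∸ N) a

fill≤ : ∀ N m a → fill N m a ≤ N
fill≤ N m zero    = m⊓n≤m N m
fill≤ N m (suc a) = fill≤ N (m ∸ N) a

fill-0 : ∀ N a → fill N 0 a ≡ 0
fill-0 N zero    = ⊓-zeroʳ N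
fill-0 N (suc a) rewrite 0∸n≡0 N = fill-0 N a

fill-mono : ∀ N {m m′} → m ≤ m′ → ∀ a → fill N m a ≤ fill N m′ a
fill-mono N m≤ zero    = ⊓-monoʳ-≤ N m≤
fill-mono N m≤ (suc a) = fill-mono N (∸-monoˡ-≤ N m≤) a

fill-antitone : ∀ N m → Antitone (fill N m)
fill-antitone N m {j = zero}  z≤n       = ≤-refl
fill-antitone N m {zero} {suc j} _      =
  ≤-trans (fill-antitone N (m ∸ N) {zero} {j} z≤n) (⊓-monoʳ-≤ N (m∸n≤m m N))
fill-antitone N m (s≤s i≤j)             = fill-antitone N (m ∸ N) i≤j

S-fill : ∀ {N} n {m} → m ≤ n * N → S n (fill N m) ≡ m
S-fill     zero        z≤n = refl
S-fill {N} (suc n) {m} m≤  =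
  trans (cong (N ⊓ m +_) (S-fill n (m≤n+o⇒m∸n≤o m N m≤))) (m⊓n+n∸m≡n N m)

fill-shift : ∀ N m a → fill N (N + m) (suc a) ≡ fill N m a
fill-shift N m a = cong (λ k → fill N k a) (m+n∸m≡n N m)

fill-+ : ∀ N m a b → fill N m (a + b) ≡ fill N (m ∸ a * N) b
fill-+ N m zero    b = refl
fill-+ N m (suc a) b = trans (fill-+ N (m ∸ N) a b) (cong (λ k → fill N k b) (∸-+-assoc m N (a * N)))

fill-≡ : ∀ N m a → fill N m a ≡ N ⊓ (m ∸ a * N)
fill-≡ N m a = trans (cong (fill N m) (sym (+-identityʳ a))) (fill-+ N m a 0)

-- Filling boxes of capacity `N * p` and then the `p` boxes inside each is one run through all small
-- boxes. This is how the lexicographic order of one power nests inside that of the next.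
fill-fill : ∀ N p m a {i} → i < p → fill N (fill (N * p) m a) i ≡ fill N m (a * p + i)
fill-fill N p m a {i} i<p = begin
  fill N (fill (N * p) m a) i                            ≡⟨ fill-≡ N _ i ⟩
  N ⊓ (fill (N * p) m a ∸ i * N)                         ≡⟨ cong (λ k → N ⊓ (k ∸ i * N)) (fill-≡ (N * p) m a) ⟩
  N ⊓ (((N * p) ⊓ (m ∸ a * (N * p))) ∸ i * N)            ≡⟨ cong (N ⊓_) (∸-distribʳ-⊓ (i * N) (N * p) _) ⟩
  N ⊓ ((N * p ∸ i * N) ⊓ (m ∸ a * (N * p) ∸ i * N))      ≡⟨ ⊓-assoc N _ _ ⟨
  (N ⊓ (N * p ∸ i * N)) ⊓ (m ∸ a * (N * p) ∸ i * N)      ≡⟨ cong (_⊓ (m ∸ a * (N * p) ∸ i * N)) (m≤n⇒m⊓n≡m room) ⟩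
  N ⊓ (m ∸ a * (N * p) ∸ i * N)                          ≡⟨ cong (N ⊓_) (∸-+-assoc m (a * (N * p)) (i * N)) ⟩
  N ⊓ (m ∸ (a * (N * p) + i * N))                        ≡⟨ cong (λ k → N ⊓ (m ∸ k)) (index N p a i) ⟩
  N ⊓ (m ∸ (a * p + i) * N)                              ≡⟨ fill-≡ N m (a * p + i) ⟨
  fill N m (a * p + i)                                   ∎
  where
  open ≡-Reasoning
  index : ∀ N p a i → a * (N * p) + i * N ≡ (a * p + i) * N
  index = solve-∀
  room : N ≤ N * p ∸ i * N
  room = ≤-trans (≤-reflexive (sym (m+n∸n≡m N (i * N))))
           (∸-monoˡ-≤ (i * N) (≤-trans (*-monoˡ-≤ N i<p) (≤-reflexive (*-comm p N))))

lt-⊓ : ∀ {i p} m → i < p → lt i (p ⊓ m) ≡ lt i m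
lt-⊓ {_}     {suc p} zero    _         = refl
lt-⊓ {zero}  {suc p} (suc m) _         = refl
lt-⊓ {suc i} {suc p} (suc m) (s≤s i<p) = lt-⊓ m i<p

lt-∸ : ∀ k m p → lt k (m ∸ p) ≡ lt (p + k) m
lt-∸ k m       zero    = refl
lt-∸ k zero    (suc p) = refl
lt-∸ k (suc m) (suc p) = lt-∸ k m p

-- Cells are numbered column by column, so the first `m` of them meet column `a` in an initial
-- segment, of length `fill p m a`.
lt-fill : ∀ {i p} m a → i < p → lt i (fill p m a) ≡ lt (a * p + i) m
lt-fill         m zero    i<p = lt-⊓ m i<p
lt-fill {i} {p} m (suc a) i<p = trans (lt-fill (m ∸ p) a i<p)
  (trans (lt-∸ (a * p + i) m p) (cong (λ k → lt k m) (sym (+-assoc p (a * p) i))))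

-- Full boxes, one arbitrary box, then empty ones: lexicographic fillings are recognised below by
-- this shape.
fill-unique : ∀ {N} n K (s : ℕ → ℕ) → (∀ c → c < K → s c ≡ N) → s K ≤ N → (∀ c → K < c → s c ≡ 0) →
              K < n → ∀ c → fill N (S n s) c ≡ s c
fill-unique {N} (suc n) zero s _ sK≤N zeros _ c = trans (cong (λ k → fill N k c) total) (go c)
  where
  total : S (suc n) s ≡ s 0
  total = trans (cong (s 0 +_) (S-zero {n} (λ i _ → zeros (suc i) (s≤s z≤n)))) (+-identityʳ (s 0))
  go : ∀ c → fill N (s 0) c ≡ s c
  go zero    = m≥n⇒m⊓n≡n sK≤N
  go (suc c) = trans (cong (λ k → fill N k c) (m≤n⇒m∸n≡0 sK≤N))
                     (trans (fill-0 N c) (sym (zeros (suc c) (s≤s z≤n))))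
fill-unique {N} (suc n) (suc K) s full sK≤N zeros (s≤s K<n) c =
  trans (cong (λ k → fill N (k + S n (s ∘ suc)) c) (full 0 (s≤s z≤n))) (go c)
  where
  go : ∀ c → fill N (N + S n (s ∘ suc)) c ≡ s c
  go zero    = trans (m≤n⇒m⊓n≡m (m≤m+n N _)) (sym (full 0 (s≤s z≤n)))
  go (suc c) = trans (fill-shift N (S n (s ∘ suc)) c)
    (fill-unique n K (s ∘ suc) (λ c c<K → full (suc c) (s≤s c<K)) sK≤N
                 (λ c K<c → zeros (suc c) (s≤s K<c)) K<n c)

-- Counting partially filled boxes

partial : ℕ → ℕ → ℕ
partial N x = lt 0 x * lt x N

partial-N : ∀ N → partial N N ≡ 0
partial-N N = trans (cong (lt 0 N *_) (lt≡0 {N} ≤-refl)) (*-zeroʳ (lt 0 N))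

partial≤1 : ∀ N x → partial N x ≤ 1
partial≤1 N x = *-mono-≤ (lt≤1 0 x) (lt≤1 x N)

partial≡1 : ∀ {N} {x} → 0 < x → x < N → partial N x ≡ 1
partial≡1 0<x x<N rewrite lt≡1 0<x | lt≡1 x<N = refl

partial≡0 : ∀ {N} {x} → x ≤ N → partial N x ≡ 0 → x ≡ 0 ⊎ x ≡ N
partial≡0 {N} {zero}  _   _ = inj₁ refl
partial≡0 {N} {suc x} x≤N e with m≤n⇒m<n∨m≡n x≤N
... | inj₂ eq  = inj₂ eq
... | inj₁ x<N = contradiction (trans (sym (partial≡1 {N} (s≤s z≤n) x<N)) e) λ ()

-- Only the box in which the supply runs out can be partial.
partial-fill≤1 : ∀ N n m → S n (partial N ∘ fill N m) ≤ 1
partial-fill≤1 N zero    m = z≤n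
partial-fill≤1 N (suc n) m with N ≤? m
... | yes N≤m rewrite m≤n⇒m⊓n≡m N≤m | partial-N N = partial-fill≤1 N n (m ∸ N)
... | no  N≰m = ≤-trans (≤-reflexive (trans (cong (partial N (N ⊓ m) +_) rest) (+-identityʳ _))) (partial≤1 N (N ⊓ m))
  where
  rest : S n (λ a → partial N (fill N (m ∸ N) a)) ≡ 0
  rest = S-zero {n} (λ a _ → trans (cong (λ k → partial N (fill N k a)) (m≤n⇒m∸n≡0 (≰⇒≥ N≰m)))
                                   (cong (partial N) (fill-0 N a)))

partial-fill≡0 : ∀ N n k → S n (partial N ∘ fill N (k * N)) ≡ 0
partial-fill≡0 N n zero = S-zero {n} (λ a _ → cong (partial N) (fill-0 N a))
partial-fill≡0 N zero    (suc k) = refl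
partial-fill≡0 N (suc n) (suc k) = trans
  (cong₂ _+_ (trans (cong (partial N) (m≤n⇒m⊓n≡m (m≤m+n N (k * N)))) (partial-N N))
             (S-cong {n} (λ a _ → cong (partial N) (fill-shift N (k * N) a))))
  (partial-fill≡0 N n k)

multiple : ∀ {N} n {s : ℕ → ℕ} → (∀ i → s i ≤ N) → S n (partial N ∘ s) ≡ 0 → ∃ λ k → S n s ≡ k * N
multiple     zero        s≤N e = 0 , refl
multiple {N} (suc n) {s} s≤N e with multiple n (s≤N ∘ suc) (m+n≡0⇒n≡0 (partial N (s 0)) e)
                                | partial≡0 (s≤N 0) (m+n≡0⇒m≡0 (partial N (s 0)) e)
... | k , eq | inj₁ z = k , trans (cong (_+ S n (s ∘ suc)) z) eq
... | k , eq | inj₂ z = suc k , cong₂ _+_ z eq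

-- A refill leaves at most one partial box, so only the case with none beforehand needs care. Then
-- the total is a multiple of `N`, and the refill has none either.
partial-fill : ∀ {N} n {s : ℕ → ℕ} → (∀ i → s i ≤ N) → S n (partial N ∘ fill N (S n s)) ≤ S n (partial N ∘ s)
partial-fill {N} n {s} s≤N with S n (partial N ∘ s) in eq
... | suc k = ≤-trans (partial-fill≤1 N n (S n s)) (s≤s z≤n)
... | zero with multiple n s≤N eq
...   | k , e = ≤-reflexive (trans (cong (λ x → S n (partial N ∘ fill N x)) e) (partial-fill≡0 N n k))

two-terms : ∀ n (f : ℕ → ℕ) {i} → suc i < n → f i + f (suc i) ≤ S n f
two-terms (suc n)       f {suc i} (s≤s i<n) = ≤-trans (two-terms n (f ∘ suc) i<n) (m≤n+m _ (f 0))
two-terms (suc (suc n)) f {zero}  _         = +-monoʳ-≤ (f 0) (m≤m+n (f 1) _)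
two-terms (suc zero)    f {zero}  (s≤s ())

first-below : ∀ {N} n {s : ℕ → ℕ} → (∀ c → s c ≤ N) →
  (∀ c → c < n → s c ≡ N) ⊎ (∃ λ K → K < n × s K < N × (∀ c → c < K → s c ≡ N))
first-below zero s≤N = inj₁ (λ c ())
first-below (suc n) {s} s≤N with m≤n⇒m<n∨m≡n (s≤N 0) | first-below n (s≤N ∘ suc)
... | inj₁ lt | _ = inj₂ (0 , s≤s z≤n , lt , λ c ())
... | inj₂ e  | inj₁ all = inj₁ λ { zero _ → e ; (suc c) (s≤s c<n) → all c c<n }
... | inj₂ e  | inj₂ (K , K<n , lt , below) =
  inj₂ (suc K , s≤s K<n , lt , λ { zero _ → e ; (suc c) (s≤s c<K) → below c c<K })

-- Moving t = x − ρ units to the heavier place.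
exchange : ∀ {ρ ρ′ x y v w} → ρ ≤ x → x + y ≡ ρ + ρ′ → v ≤ w → w * ρ + v * ρ′ ≤ w * x + v * y
exchange {ρ} {ρ′} {x} {y} {v} {w} ρ≤x eq v≤w with x ∸ ρ | m+[n∸m]≡n ρ≤x
... | t | refl = begin
  w * ρ + v * ρ′            ≡⟨ cong (λ k → w * ρ + v * k) (+-cancelˡ-≡ ρ _ _ (trans (sym eq) (+-assoc ρ t y))) ⟩
  w * ρ + v * (t + y)       ≡⟨ lhs v w ρ t y ⟩
  w * ρ + v * y + v * t     ≤⟨ +-monoʳ-≤ (w * ρ + v * y) (*-monoˡ-≤ t v≤w) ⟩
  w * ρ + v * y + w * t     ≡⟨ rhs v w ρ t y ⟩
  w * (ρ + t) + v * y       ∎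
  where
  open ≤-Reasoning
  lhs : ∀ v w ρ t y → w * ρ + v * (t + y) ≡ w * ρ + v * y + v * t
  lhs = solve-∀
  rhs : ∀ v w ρ t y → w * ρ + v * y + w * t ≡ w * (ρ + t) + v * y
  rhs = solve-∀

fill-pair : ∀ N {ρ ρ′} → ρ ≤ N → ρ′ ≤ N → let M = ρ + ρ′ in
  ρ ≤ fill N M 0 × fill N M 0 + fill N M 1 ≡ M × (∀ c → fill N M (2 + c) ≡ 0)
fill-pair N {ρ} {ρ′} ρ≤N ρ′≤N =
    ⊓-glb ρ≤N (m≤m+n ρ ρ′)
  , trans (cong (fill N (ρ + ρ′) 0 +_) (sym (+-identityʳ (fill N (ρ + ρ′) 1)))) (S-fill {N} 2 M≤2N)
  , λ c → trans (cong (λ k → fill N k c) (trans (∸-+-assoc (ρ + ρ′) N N) (m≤n⇒m∸n≡0 M≤N+N))) (fill-0 N c)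
  where
  M≤N+N : ρ + ρ′ ≤ N + N
  M≤N+N = +-mono-≤ ρ≤N ρ′≤N
  M≤2N : ρ + ρ′ ≤ 2 * N
  M≤2N = ≤-trans M≤N+N (≤-reflexive (cong (N +_) (sym (+-identityʳ N))))

-- `fill` keeps the `K` full boxes in front, so the comparison concerns boxes `K` and `suc K` alone.
-- There the hypothesis on `F` covers the edges inside boxes and `exchange` covers the weights,
-- since units only move towards the heavier box `K`.
merge : ∀ {N} (F w : ℕ → ℕ) K n (s : ℕ → ℕ) → (∀ c → s c ≤ N) →
  (∀ c → c < K → s c ≡ N) → (∀ c → s (2 + K + c) ≡ 0) → w (suc K) ≤ w K →
  (let M = s K + s (suc K) in F (s K) + F (s (suc K)) ≤ F (fill N M 0) + F (fill N M 1)) →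
  S (K + (2 + n)) (λ c → F (s c) + w c * s c) ≤
  S (K + (2 + n)) (λ c → F (fill N (S (K + (2 + n)) s) c) + w c * fill N (S (K + (2 + n)) s) c)
merge {N} F w zero n s s≤N _ zeros w≤ F≤ = begin
  S (2 + n) (λ c → F (s c) + w c * s c)
    ≡⟨ cong (λ k → F (s 0) + w 0 * s 0 + (F (s 1) + w 1 * s 1 + k))
         (S-cong {n} (λ c _ → cong (λ k → F k + w (2 + c) * k) (trans (zeros c) (sym (z c))))) ⟩
  F (s 0) + w 0 * s 0 + (F (s 1) + w 1 * s 1 + rest)
    ≡⟨ shuffle (F (s 0)) _ (F (s 1)) _ rest ⟩
  (F (s 0) + F (s 1)) + (w 0 * s 0 + w 1 * s 1) + rest
    ≤⟨ +-monoˡ-≤ rest (+-mono-≤ F≤ (exchange ρ≤ xy w≤)) ⟩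
  (F x + F y) + (w 0 * x + w 1 * y) + rest
    ≡⟨ shuffle (F x) _ (F y) _ rest ⟨
  F x + w 0 * x + (F y + w 1 * y + rest)
    ≡⟨ S-cong {2 + n} (λ c _ → cong (λ k → F (fill N k c) + w c * fill N k c) total) ⟨
  S (2 + n) (λ c → F (fill N (S (2 + n) s) c) + w c * fill N (S (2 + n) s) c) ∎
  where
  open ≤-Reasoning
  M = s 0 + s 1
  x = fill N M 0
  y = fill N M 1
  ρ≤ = proj₁ (fill-pair N (s≤N 0) (s≤N 1))
  xy = proj₁ (proj₂ (fill-pair N (s≤N 0) (s≤N 1)))
  z  = proj₂ (proj₂ (fill-pair N (s≤N 0) (s≤N 1)))
  rest = S n (λ c → F (fill N M (2 + c)) + w (2 + c) * fill N M (2 + c))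
  total : S (2 + n) s ≡ M
  total = cong (s 0 +_) (trans (cong (s 1 +_) (S-zero {n} (λ c _ → zeros c))) (+-identityʳ (s 1)))
  shuffle : ∀ a b c d e → a + b + (c + d + e) ≡ (a + c) + (b + d) + e
  shuffle = solve-∀
merge {N} F w (suc K) n s s≤N full zeros w≤ F≤ = begin
  F (s 0) + w 0 * s 0 + S k (λ c → F (s (suc c)) + w (suc c) * s (suc c))
    ≤⟨ +-monoʳ-≤ (F (s 0) + w 0 * s 0) (merge F (w ∘ suc) K n (s ∘ suc) (s≤N ∘ suc)
         (λ c c<K → full (suc c) (s≤s c<K)) zeros w≤ F≤) ⟩
  F (s 0) + w 0 * s 0 + S k (λ c → F (fill N M c) + w (suc c) * fill N M c)
    ≡⟨ cong₂ _+_ (cong (λ k → F k + w 0 * k) (trans s0≡N (sym (m≤n⇒m⊓n≡m (m≤m+n N M)))))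
         (S-cong {k} (λ c _ → cong (λ k → F k + w (suc c) * k) (sym (fill-shift N M c)))) ⟩
  S (suc k) (λ c → F (fill N (N + M) c) + w c * fill N (N + M) c)
    ≡⟨ S-cong {suc k} (λ c _ → cong (λ m → F (fill N (m + M) c) + w c * fill N (m + M) c) (sym s0≡N)) ⟩
  S (suc k) (λ c → F (fill N (s 0 + M) c) + w c * fill N (s 0 + M) c) ∎
  where
  open ≤-Reasoning
  k = K + (2 + n)
  M = S k (s ∘ suc)
  s0≡N = full 0 (s≤s z≤n)

-- The lexicographic order on a power of a chain

module Lex (p : ℕ) (δ : ℕ → ℕ) where

  -- For the δ-sequence of a graph `G` with nested solutions these partial sums are the values
  -- `I G k`, for `k` up to the order of `G`.
  J : ℕ → ℕ
  J k = S k δ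

  -- The edge count in `H □ G` of a stack of nested optimal sets: column `a` has `F (f a)` inner
  -- edges, and each of its `f a` vertices sends `δ a` edges to earlier columns.
  colval : (ℕ → ℕ) → (ℕ → ℕ) → ℕ
  colval F f = S p (λ a → F (f a) + δ a * f a)

  L : (ℕ → ℕ) → ℕ → ℕ → ℕ
  L F N m = colval F (fill N m)

  -- With F the edge counts of the optimal sets of a graph H of order N, OPT says that filling one copy of H
  -- after another is optimal in H □ G.
  OPT : (ℕ → ℕ) → ℕ → Set
  OPT F N = ∀ f → Antitone f → (∀ a → f a ≤ N) → colval F f ≤ L F N (S p f)

  colval-shift : ∀ F d g → S p (λ i → F (g i) + (d + δ i) * g i) ≡ colval F g + d * S p g
  colval-shift F d g = begin
    S p (λ i → F (g i) + (d + δ i) * g i)              ≡⟨ S-cong {p} (λ i _ → regroup (F (g i)) d (δ i) (g i)) ⟩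
    S p (λ i → F (g i) + δ i * g i + d * g i)          ≡⟨ ∑-distrib-+ {p} (λ i → F (g (toℕ i)) + δ (toℕ i) * g (toℕ i)) (λ i → d * g (toℕ i)) ⟩
    colval F g + S p (λ i → d * g i)                   ≡⟨ cong (colval F g +_) (*-distribˡ-sum {p} d (g ∘ toℕ)) ⟨
    colval F g + d * S p g                             ∎
    where
    open ≡-Reasoning
    regroup : ∀ a d e g → a + (d + e) * g ≡ a + e * g + d * g
    regroup = solve-∀

  J-column : ∀ d {k} → k ≤ p → S p (λ i → (d + δ i) * lt i k) ≡ J k + d * k
  J-column d {k} k≤p = begin
    S p (λ i → (d + δ i) * lt i k)        ≡⟨ colval-shift (λ _ → 0) d (λ i → lt i k) ⟩
    S p (λ i → δ i * lt i k) + d * S p (λ i → lt i k) ≡⟨ cong₂ (λ x y → x + d * y) (S-*lt p δ k≤p) (S-lt p k≤p) ⟩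
    J k + d * k                           ∎
    where open ≡-Reasoning

-- Lexicographic optimality passes to the next power

module Cells (q : ℕ) (δ F : ℕ → ℕ) (N : ℕ)
  (optF : Lex.OPT (2 + q) δ F N) (optJ : Lex.OPT (2 + q) δ (Lex.J (2 + q) δ) (2 + q))
  -- Together these two compare cells across a column boundary: the first cell of column `suc a`
  -- weighs no more than the last cell of column `a`.
  (δ0 : δ 0 ≡ 0) (slope : ∀ a → 2 + a ≤ 2 + q → δ (suc a) ≤ δ a + δ (suc q)) where

  p : ℕ
  p = 2 + q

  open Lex p δ

  -- Cell `c` is place `c % p` of column `c / p`, which numbers the grid lexicographically. The
  -- weight is the number of edges credited to each unit in the box towards earlier boxes.
  w : ℕ → ℕ
  w c = δ (c / p) + δ (c % p)

  div-block : ∀ a {i} → i < p → (a * p + i) / p ≡ a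
  div-block a {i} i<p = trans (+-distrib-/-∣ˡ i (n∣m*n a))
    (trans (cong₂ _+_ (m*n/n≡m a p) (m<n⇒m/n≡0 i<p)) (+-identityʳ a))

  mod-block : ∀ a {i} → i < p → (a * p + i) % p ≡ i
  mod-block a {i} i<p = trans (cong (_% p) (+-comm (a * p) i)) (trans ([m+kn]%n≡m%n i a p) (m<n⇒m%n≡m i<p))

  w-block : ∀ a {i} → i < p → w (a * p + i) ≡ δ a + δ i
  w-block a i<p = cong₂ (λ x y → δ x + δ y) (div-block a i<p) (mod-block a i<p)

  S-column : ∀ {x} → x ≤ N * p → S p (fill N x) ≡ x
  S-column x≤ = S-fill {N} p (≤-trans x≤ (≤-reflexive (*-comm N p)))

  cellval : (ℕ → ℕ) → ℕ
  cellval s = S (p * p) (λ c → F (s c) + w c * s c)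

  gridval : (ℕ → ℕ → ℕ) → ℕ
  gridval r = S p (λ a → S p (λ i → F (r a i) + (δ a + δ i) * r a i))

  flat : (ℕ → ℕ → ℕ) → ℕ → ℕ
  flat r c = r (c / p) (c % p)

  flat-block : ∀ r a {i} → i < p → flat r (a * p + i) ≡ r a i
  flat-block r a i<p = cong₂ r (div-block a i<p) (mod-block a i<p)

  cellval-block : ∀ s → cellval s ≡ gridval (λ a i → s (a * p + i))
  cellval-block s = trans (S-block p p (λ c → F (s c) + w c * s c))
    (S-cong {p} λ a _ → S-cong {p} λ i i<p → cong (λ k → F (s (a * p + i)) + k * s (a * p + i)) (w-block a i<p))

  S-flat : ∀ (Φ : ℕ → ℕ) r → S (p * p) (Φ ∘ flat r) ≡ S p (λ a → S p (Φ ∘ r a))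
  S-flat Φ r = trans (S-block p p (Φ ∘ flat r))
    (S-cong {p} λ a _ → S-cong {p} λ i i<p → cong Φ (flat-block r a i<p))

  gridval-flat : ∀ r → gridval r ≡ cellval (flat r)
  gridval-flat r = sym (trans (cellval-block (flat r))
    (S-cong {p} λ a _ → S-cong {p} λ i i<p → cong (λ k → F k + (δ a + δ i) * k) (flat-block r a i<p)))

  gridval-columns : ∀ (f : ℕ → ℕ) → (∀ a → f a ≤ N * p) →
    gridval (λ a → fill N (f a)) ≡ S p (λ a → L F N (f a) + δ a * f a)
  gridval-columns f f≤ = S-cong {p} λ a _ → trans (colval-shift F (δ a) (fill N (f a)))
    (cong (λ k → L F N (f a) + δ a * k) (S-column (f≤ a)))

  AntitoneGrid : (ℕ → ℕ → ℕ) → Set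
  AntitoneGrid r = (∀ a → Antitone (r a)) × (∀ i → Antitone (λ a → r a i))

  -- The cells holding more than `h` form a staircase with `g a` cells in column `a`. Its total
  -- weight is the edge count of a compressed set in the square of `G`, so `optJ` bounds it by the
  -- weight of the first `m` cells.
  level-≤ : ∀ {r} → AntitoneGrid r → ∀ h → let m = S (p * p) (λ c → lt h (flat r c)) in
    S (p * p) (λ c → w c * lt h (flat r c)) ≤ S (p * p) (λ c → w c * lt c m)
  level-≤ {r} (anti₂ , anti₁) h = begin
    S (p * p) (λ c → w c * lt h (flat r c))
      ≡⟨ S-block p p (λ c → w c * lt h (flat r c)) ⟩
    S p (λ a → S p (λ i → w (a * p + i) * lt h (flat r (a * p + i))))
      ≡⟨ S-cong {p} (λ a _ → S-cong {p} λ i i<p → cong₂ _*_ (w-block a i<p)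
           (trans (cong (lt h) (flat-block r a i<p)) (sym (lt-τ {p} {r a} (anti₂ a) h i<p)))) ⟩
    S p (λ a → S p (λ i → (δ a + δ i) * lt i (g a)))
      ≡⟨ S-cong {p} (λ a _ → J-column (δ a) (g≤p a)) ⟩
    colval J g
      ≤⟨ optJ g (λ a≤b → τ-mono {p} (λ c → anti₁ (toℕ c) a≤b) h) g≤p ⟩
    colval J (fill p (S p g))
      ≡⟨ cong (λ k → colval J (fill p k)) (S-flat (lt h) r) ⟨
    colval J (fill p m)
      ≡⟨ S-cong {p} (λ a _ → J-column (δ a) (fill≤ p m a)) ⟨
    S p (λ a → S p (λ i → (δ a + δ i) * lt i (fill p m a)))
      ≡⟨ S-cong {p} (λ a _ → S-cong {p} λ i i<p → cong₂ _*_ (sym (w-block a i<p)) (lt-fill m a i<p)) ⟩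
    S p (λ a → S p (λ i → w (a * p + i) * lt (a * p + i) m))
      ≡⟨ S-block p p (λ c → w c * lt c m) ⟨
    S (p * p) (λ c → w c * lt c m) ∎
    where
    open ≤-Reasoning
    g : ℕ → ℕ
    g a = τ {p} (r a ∘ toℕ) h
    g≤p : ∀ a → g a ≤ p
    g≤p a = τ≤ {p} (r a ∘ toℕ) h
    m = S (p * p) (λ c → lt h (flat r c))

  layers : ∀ n (x : ℕ → ℕ) (y : ℕ → ℕ → ℕ) →
    S n (λ c → x c * S N (λ h → y c h)) ≡ S N (λ h → S n (λ c → x c * y c h))
  layers n x y = trans (S-cong {n} λ c _ → *-distribˡ-sum {N} (x c) (λ h → y c (toℕ h)))
    (∑-comm {n} {N} (λ c h → x (toℕ c) * y (toℕ c) (toℕ h)))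

  sorted : (ℕ → ℕ → ℕ) → ℕ → ℕ
  sorted r = srt {p * p} N (flat r ∘ toℕ)

  flat≤ : ∀ {r} → (∀ a i → r a i ≤ N) → ∀ c → flat r c ≤ N
  flat≤ r≤N c = r≤N (c / p) (c % p)

  sorted-antitone : ∀ r → Antitone (sorted r)
  sorted-antitone r = srt-antitone {p * p} N (flat r ∘ toℕ)

  sorted≤N : ∀ r c → sorted r c ≤ N
  sorted≤N r c = srt≤ {p * p} N (flat r ∘ toℕ) c

  sorted-outside : ∀ r c → p * p ≤ c → sorted r c ≡ 0
  sorted-outside r c = srt≡0 {p * p} N (flat r ∘ toℕ)

  S-sorted : ∀ {r} → (∀ a i → r a i ≤ N) → ∀ Φ → S (p * p) (Φ ∘ sorted r) ≡ S p (λ a → S p (Φ ∘ r a))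
  S-sorted {r} r≤N Φ = trans (sum-srt {p * p} {N} {flat r ∘ toℕ} (λ c → flat≤ r≤N (toℕ c)) Φ) (S-flat Φ r)

  -- Rearranging the boxes keeps the sum of `F`. The weighted part is a sum over levels, and sorting
  -- turns each level set into an initial segment of the same size, to which `level-≤` applies.
  sorted-≤ : ∀ {r} → AntitoneGrid r → (∀ a i → r a i ≤ N) → gridval r ≤ cellval (sorted r)
  sorted-≤ {r} anti r≤N = begin
    gridval r                                                   ≡⟨ gridval-flat r ⟩
    S n (λ c → F (u c) + w c * u c)                             ≡⟨ ∑-distrib-+ {n} (λ c → F (u (toℕ c))) (λ c → w (toℕ c) * u (toℕ c)) ⟩
    S n (F ∘ u) + S n (λ c → w c * u c)                         ≤⟨ +-mono-≤ (≤-reflexive (sym (sum-srt {n} u≤N F))) weights ⟩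
    S n (F ∘ sorted r) + S n (λ c → w c * sorted r c)           ≡⟨ ∑-distrib-+ {n} (λ c → F (sorted r (toℕ c))) (λ c → w (toℕ c) * sorted r (toℕ c)) ⟨
    cellval (sorted r)                                          ∎
    where
    open ≤-Reasoning
    n = p * p
    u = flat r
    u≤N : (c : Fin n) → u (toℕ c) ≤ N
    u≤N c = flat≤ r≤N (toℕ c)
    weights : S n (λ c → w c * u c) ≤ S n (λ c → w c * sorted r c)
    weights = begin
      S n (λ c → w c * u c)                             ≡⟨ S-cong {n} (λ c _ → cong (w c *_) (sym (S-lt N (flat≤ r≤N c)))) ⟩
      S n (λ c → w c * S N (λ h → lt h (u c)))          ≡⟨ layers n w (λ c h → lt h (u c)) ⟩
      S N (λ h → S n (λ c → w c * lt h (u c)))          ≤⟨ S-mono {N} (λ h _ → level-≤ anti h) ⟩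
      S N (λ h → S n (λ c → w c * lt c (τ {n} (u ∘ toℕ) h))) ≡⟨ layers n w (λ c h → lt c (τ {n} (u ∘ toℕ) h)) ⟨
      S n (λ c → w c * sorted r c)                      ∎

  column-grid : (ℕ → ℕ) → ℕ → ℕ → ℕ
  column-grid f a = fill N (f a)

  column-grid-antitone : ∀ {f} → Antitone f → AntitoneGrid (column-grid f)
  column-grid-antitone {f} anti = (λ a → fill-antitone N (f a)) , (λ i a≤b → fill-mono N (anti a≤b) i)

  -- One round: the total `f a` of each column is redistributed lexicographically inside it, and
  -- then all boxes of the grid are sorted.
  module Round {s : ℕ → ℕ} (anti : Antitone s) (s≤N : ∀ c → s c ≤ N) where
    f : ℕ → ℕ
    f a = S p (λ i → s (a * p + i))

    f-antitone : Antitone f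
    f-antitone a≤b = S-mono {p} (λ i _ → anti (+-monoˡ-≤ i (*-monoˡ-≤ p a≤b)))

    f≤ : ∀ a → f a ≤ N * p
    f≤ a = ≤-trans (sum≤* {p} (λ i → s≤N (a * p + toℕ i))) (≤-reflexive (*-comm p N))

    s′ : ℕ → ℕ
    s′ = sorted (column-grid f)

    grid≤N : ∀ a i → column-grid f a i ≤ N
    grid≤N a i = fill≤ N (f a) i

    improves : cellval s ≤ cellval s′
    improves = begin
      cellval s                              ≡⟨ cellval-block s ⟩
      gridval (λ a i → s (a * p + i))        ≡⟨ S-cong {p} (λ a _ → colval-shift F (δ a) (λ i → s (a * p + i))) ⟩
      S p (λ a → colval F (λ i → s (a * p + i)) + δ a * f a)
        ≤⟨ S-mono {p} (λ a _ → +-monoˡ-≤ (δ a * f a)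
             (optF _ (λ i≤j → anti (+-monoʳ-≤ (a * p) i≤j)) (λ i → s≤N _))) ⟩
      S p (λ a → L F N (f a) + δ a * f a)    ≡⟨ gridval-columns f f≤ ⟨
      gridval (column-grid f)                ≤⟨ sorted-≤ (column-grid-antitone f-antitone) grid≤N ⟩
      cellval s′                             ∎
      where open ≤-Reasoning

    total : S (p * p) s′ ≡ S (p * p) s
    total = begin
      S (p * p) s′                         ≡⟨ S-sorted grid≤N (λ x → x) ⟩
      S p (λ a → S p (fill N (f a)))       ≡⟨ S-cong {p} (λ a _ → S-column (f≤ a)) ⟩
      S p f                                ≡⟨ S-block p p s ⟨
      S (p * p) s                          ∎
      where open ≡-Reasoning

    -- Sorting keeps the number of partial boxes and refilling raises it in no column. In column `a`
    -- it drops strictly, from at least two to at most one.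
    fewer : ∀ a i → a < p → suc i < p → partial N (s (a * p + i)) ≡ 1 → partial N (s (a * p + suc i)) ≡ 1 →
            S (p * p) (partial N ∘ s′) < S (p * p) (partial N ∘ s)
    fewer a i a<p i<p e₁ e₂ = begin-strict
      S (p * p) (partial N ∘ s′)                     ≡⟨ S-sorted grid≤N (partial N) ⟩
      S p (λ a → S p (partial N ∘ fill N (f a)))     <⟨ sum-mono-< {p} (λ a → partial-fill p {λ i → s (toℕ a * p + i)} (λ i → s≤N _)) (fromℕ< a<p)
                                                          (subst (λ a → S p (partial N ∘ fill N (f a)) < S p (λ i → partial N (s (a * p + i))))
                                                            (sym (toℕ-fromℕ< a<p)) drop) ⟩
      S p (λ a → S p (λ i → partial N (s (a * p + i)))) ≡⟨ S-block p p (partial N ∘ s) ⟨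
      S (p * p) (partial N ∘ s)                      ∎
      where
      open ≤-Reasoning
      drop : S p (partial N ∘ fill N (f a)) < S p (λ i → partial N (s (a * p + i)))
      drop = begin-strict
        S p (partial N ∘ fill N (f a))   ≤⟨ partial-fill≤1 N p (f a) ⟩
        1                                <⟨ n<1+n 1 ⟩
        2                                ≡⟨ cong₂ _+_ e₁ e₂ ⟨
        partial N (s (a * p + i)) + partial N (s (a * p + suc i)) ≤⟨ two-terms p (λ i → partial N (s (a * p + i))) i<p ⟩
        S p (λ i → partial N (s (a * p + i))) ∎

  -- Apply `optF` to the columns `ρ , ρ′ , 0 , …`. The term with `δ 1` is at least as large before
  -- the refill as after it, because `y ≤ ρ′`, so it can be cancelled.
  pair-≤ : ∀ {ρ ρ′} → ρ ≤ N → ρ′ ≤ ρ → let M = ρ + ρ′ in F ρ + F ρ′ ≤ F (fill N M 0) + F (fill N M 1)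
  pair-≤ {ρ} {ρ′} ρ≤N ρ′≤ρ = +-cancelʳ-≤ (δ 1 * y + rest) _ _ (begin
    F ρ + F ρ′ + (δ 1 * y + rest)
      ≤⟨ +-monoʳ-≤ (F ρ + F ρ′) (+-monoˡ-≤ rest (*-monoʳ-≤ (δ 1) y≤ρ′)) ⟩
    F ρ + F ρ′ + (δ 1 * ρ′ + rest)
      ≡⟨ shuffle (F ρ) (F ρ′) (δ 1 * ρ′) rest ρ ⟩
    F ρ + 0 * ρ + (F ρ′ + δ 1 * ρ′ + rest)
      ≡⟨ cong (λ k → F ρ + k * ρ + (F ρ′ + δ 1 * ρ′ + rest)) δ0 ⟨
    colval F f
      ≤⟨ optF f f-antitone f≤N ⟩
    colval F (fill N (S p f))
      ≡⟨ cong (λ k → colval F (fill N k)) total ⟩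
    F x + δ 0 * x + (F y + δ 1 * y + S q (λ i → F (fill N M (2 + i)) + δ (2 + i) * fill N M (2 + i)))
      ≡⟨ cong (λ k → F x + δ 0 * x + (F y + δ 1 * y + k))
           (S-cong {q} (λ i _ → cong (λ k → F k + δ (2 + i) * k) (proj₂ (proj₂ (fill-pair N ρ≤N ρ′≤N)) i))) ⟩
    F x + δ 0 * x + (F y + δ 1 * y + rest)
      ≡⟨ cong (λ k → F x + k * x + (F y + δ 1 * y + rest)) δ0 ⟩
    F x + 0 * x + (F y + δ 1 * y + rest)
      ≡⟨ shuffle (F x) (F y) (δ 1 * y) rest x ⟨
    F x + F y + (δ 1 * y + rest) ∎)
    where
    open ≤-Reasoning
    M = ρ + ρ′
    x = fill N M 0
    y = fill N M 1
    ρ′≤N = ≤-trans ρ′≤ρ ρ≤N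
    f : ℕ → ℕ
    f 0 = ρ
    f 1 = ρ′
    f (suc (suc _)) = 0
    f-antitone : Antitone f
    f-antitone {_} {suc (suc _)} _ = z≤n
    f-antitone {0} {0} _ = ≤-refl
    f-antitone {0} {1} _ = ρ′≤ρ
    f-antitone {1} {1} _ = ≤-refl
    f-antitone {suc (suc _)} {1} (s≤s ())
    f≤N : ∀ a → f a ≤ N
    f≤N a = ≤-trans (f-antitone {0} {a} z≤n) ρ≤N
    rest = S q (λ i → F 0 + δ (2 + i) * 0)
    total : S p f ≡ M
    total = cong (ρ +_) (trans (cong (ρ′ +_) (S-zero {q} (λ _ _ → refl))) (+-identityʳ ρ′))
    y≤ρ′ : y ≤ ρ′
    y≤ρ′ = +-cancelˡ-≤ ρ y ρ′ (≤-trans (+-monoˡ-≤ y (proj₁ (fill-pair N ρ≤N ρ′≤N)))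
             (≤-reflexive (proj₁ (proj₂ (fill-pair N ρ≤N ρ′≤N)))))
    shuffle : ∀ a b c d r → a + b + (c + d) ≡ a + 0 * r + (b + c + d)
    shuffle = solve-∀

  Settled : (ℕ → ℕ) → Set
  Settled s = cellval s ≤ cellval (fill N (S (p * p) s))

  settled-≗ : ∀ {s} → (∀ c → fill N (S (p * p) s) c ≡ s c) → Settled s
  settled-≗ e = ≤-reflexive (S-cong {p * p} (λ c _ → cong (λ k → F k + w c * k) (sym (e c))))

  -- Induction on a bound for the number of partial boxes. Let `K` be the first box that is not
  -- full. If `suc K` is nonempty, both are partial, and either a round makes progress or these two
  -- are the last nonempty boxes and sit on both sides of a column boundary.
  settle : ∀ fuel {s} → Antitone s → (∀ c → s c ≤ N) → (∀ c → p * p ≤ c → s c ≡ 0) →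
           S (p * p) (partial N ∘ s) < fuel → Settled s
  settle (suc fuel) {s} anti s≤N outside enough with first-below (p * p) s≤N
  -- `fill-unique` asks for a box `K` inside the grid; with every box full, the last one serves.
  ... | inj₁ all = settled-≗ (fill-unique (p * p) (p * p ∸ 1) s (λ c c<K → all c (<-trans c<K ≤-refl))
                     (s≤N (p * p ∸ 1)) (λ c K<c → outside c K<c) ≤-refl)
  ... | inj₂ (K , K<n , sK<N , full) with s (suc K) ≟ 0
  ...   | yes z = settled-≗ (fill-unique (p * p) K s full (s≤N K)
                    (λ c K<c → n≤0⇒n≡0 (≤-trans (anti K<c) (≤-reflexive z))) K<n)
  ...   | no nz = split (m≤n⇒m<n∨m≡n (m%n<n K p))
    where
    a = K / p
    i = K % p
    K≡ : K ≡ a * p + i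
    K≡ = trans (m≡m%n+[m/n]*n K p) (+-comm i (a * p))
    inside : ∀ {c} → s c ≢ 0 → c < p * p
    inside {c} ne = ≰⇒> (λ n≤c → ne (outside c n≤c))
    is-partial : ∀ {c} → K ≤ c → s c ≢ 0 → partial N (s c) ≡ 1
    is-partial K≤c ne = partial≡1 (n≢0⇒n>0 ne) (≤-<-trans (anti K≤c) sK<N)
    open Round anti s≤N
    -- Boxes `j` and `suc j` of column `b` come no earlier than `K` and are nonempty, so both are
    -- partial and another round lowers the count.
    again : ∀ b j → suc j < p → K ≤ b * p + j → s (b * p + suc j) ≢ 0 → Settled s
    again b j j<p K≤ ne = begin
      cellval s                              ≤⟨ improves ⟩
      cellval s′                             ≤⟨ settle fuel (sorted-antitone (column-grid f)) (sorted≤N (column-grid f)) (sorted-outside (column-grid f))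
                                                  (<-≤-trans (fewer b j b<p j<p (is-partial K≤ ne′) (is-partial K≤′ ne)) (s≤s⁻¹ enough)) ⟩
      cellval (fill N (S (p * p) s′))        ≡⟨ cong (λ k → cellval (fill N k)) total ⟩
      cellval (fill N (S (p * p) s))         ∎
      where
      open ≤-Reasoning
      up : b * p + j ≤ b * p + suc j
      up = +-monoʳ-≤ (b * p) (n≤1+n j)
      K≤′ = ≤-trans K≤ up
      ne′ : s (b * p + j) ≢ 0
      ne′ e = ne (n≤0⇒n≡0 (≤-trans (anti up) (≤-reflexive e)))
      b<p : b < p
      b<p = *-cancelʳ-< p b p (≤-<-trans (m≤m+n (b * p) (suc j)) (inside ne))
    next-column : suc i ≡ p → suc K ≡ suc a * p + 0
    next-column i≡ = trans (cong suc K≡) (trans (sym (+-suc (a * p) i)) (trans (cong (a * p +_) i≡)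
      (trans (+-comm (a * p) p) (sym (+-identityʳ (suc a * p))))))
    split : suc i < p ⊎ suc i ≡ p → Settled s
    split (inj₁ i<p) = again a i i<p (≤-reflexive K≡)
      (subst (λ c → s c ≢ 0) (trans (cong suc K≡) (sym (+-suc (a * p) i))) nz)
    split (inj₂ i≡) with s (2 + K) ≟ 0
    -- `K` ends its column, so `suc K` and `2 + K` are places 0 and 1 of the next one.
    ... | no nz′ = again (suc a) 0 (s≤s (s≤s z≤n)) (≤-trans (n≤1+n K) (≤-reflexive (next-column i≡)))
                     (subst (λ c → s c ≢ 0) (trans (cong suc (next-column i≡)) (sym (+-suc (suc a * p) 0))) nz′)
    -- Everything after `suc K` is empty, and the two remaining partial boxes are merged. The
    -- `subst` only rewrites the number of cells as `K + (2 + n)`.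
    ... | yes z′ = subst (λ n → S n (λ c → F (s c) + w c * s c) ≤
                                S n (λ c → F (fill N (S n s) c) + w c * fill N (S n s) c))
                     (trans (sym (+-assoc K 2 _)) (trans (cong (_+ (p * p ∸ (2 + K))) (+-comm K 2)) (m+[n∸m]≡n (inside nz))))
                     (merge F w K (p * p ∸ (2 + K)) s s≤N full
                       (λ c → n≤0⇒n≡0 (≤-trans (anti (m≤m+n (2 + K) c)) (≤-reflexive z′)))
                       w≤ (pair-≤ (s≤N K) (anti (n≤1+n K))))
      where
      a<p : suc a < p
      a<p = *-cancelʳ-< p (suc a) p (≤-<-trans (≤-trans (m≤m+n (suc a * p) 0) (≤-reflexive (sym (next-column i≡)))) (inside nz))
      w≤ : w (suc K) ≤ w K
      w≤ = begin
        w (suc K)              ≡⟨ cong w (next-column i≡) ⟩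
        w (suc a * p + 0)      ≡⟨ w-block (suc a) (s≤s z≤n) ⟩
        δ (suc a) + δ 0        ≡⟨ trans (cong (δ (suc a) +_) δ0) (+-identityʳ _) ⟩
        δ (suc a)              ≤⟨ slope a a<p ⟩
        δ a + δ (suc q)        ≡⟨ cong (λ k → δ a + δ k) (suc-injective i≡) ⟨
        w K                    ∎
        where open ≤-Reasoning

  -- A column of capacity `N * p` is opened into `p` boxes, which makes `f` a grid filled column by
  -- column. Sorting and settling lead to the lexicographic filling of all boxes, and `fill-fill`
  -- closes the columns again.
  OPT-step : OPT (L F N) (N * p)
  OPT-step f anti f≤ = begin
    S p (λ a → L F N (f a) + δ a * f a)     ≡⟨ gridval-columns f f≤ ⟨
    gridval (column-grid f)                 ≤⟨ sorted-≤ (column-grid-antitone anti) (λ a i → fill≤ N (f a) i) ⟩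
    cellval s                               ≤⟨ settle (suc (S (p * p) (partial N ∘ s))) (sorted-antitone r) (sorted≤N r) (sorted-outside r) ≤-refl ⟩
    cellval (fill N (S (p * p) s))          ≡⟨ cong (λ k → cellval (fill N k)) total ⟩
    cellval (fill N M)                      ≡⟨ cellval-block (fill N M) ⟩
    gridval (λ a i → fill N M (a * p + i))  ≡⟨ S-cong {p} (λ a _ → S-cong {p} λ i i<p →
                                                  cong (λ k → F k + (δ a + δ i) * k) (sym (fill-fill N p M a i<p))) ⟩
    gridval (column-grid (fill (N * p) M))  ≡⟨ gridval-columns (fill (N * p) M) (fill≤ (N * p) M) ⟩
    L (L F N) (N * p) M                     ∎
    where
    open ≤-Reasoning
    M = S p f
    r = column-grid f
    s = sorted r
    total : S (p * p) s ≡ M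
    total = trans (S-sorted (λ a i → fill≤ N (f a) i) (λ x → x)) (S-cong {p} (λ a _ → S-column (f≤ a)))

-- Nested optima of the square are lexicographic up to transposition

module Square (p : ℕ) (δ : ℕ → ℕ) where

  open Lex p δ

  -- What compression leaves of nested solutions of the square: an increasing chain of staircases in
  -- the `p` by `p` grid, each of maximal value among staircases of its size.
  record NestedOptima (f : ℕ → ℕ → ℕ) : Set where
    field
      antitone : ∀ m → Antitone (f m)
      bounded  : ∀ m a → f m a ≤ p
      outside  : ∀ m {a} → p ≤ a → f m a ≡ 0
      total    : ∀ {m} → m ≤ p * p → S p (f m) ≡ m
      nested   : ∀ {m} → suc m ≤ p * p → ∀ a → f m a ≤ f (suc m) a
      optimal  : ∀ {m} → m ≤ p * p → ∀ g → Antitone g → (∀ a → g a ≤ p) → S p g ≡ m →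
                 colval J g ≤ colval J (f m)

  conj : (ℕ → ℕ) → ℕ → ℕ
  conj f = τ {p} (f ∘ toℕ)

  conj-involutive : ∀ {f} → Antitone f → (∀ a → f a ≤ p) → ∀ {a} → a < p → conj (conj f) a ≡ f a
  conj-involutive {f} anti f≤p {a} a<p =
    trans (S-cong {p} (λ h _ → lt-τ {p} {f} anti h a<p)) (S-lt p (f≤p a))

  -- Transposition exchanges the edges inside columns with the edges across them; by layer-cake
  -- summation the two parts of `colval` trade places.
  colval-conj : ∀ {f} → Antitone f → (∀ a → f a ≤ p) → colval J (conj f) ≡ colval J f
  colval-conj {f} anti f≤p = begin
    colval J (conj f)
      ≡⟨ ∑-distrib-+ {p} (λ h → J (conj f (toℕ h))) (λ h → δ (toℕ h) * conj f (toℕ h)) ⟩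
    S p (J ∘ conj f) + S p (λ h → δ h * conj f h)
      ≡⟨ cong₂ _+_ (sym (S-τ {p} {p} {conj f ∘ toℕ} (λ h → τ≤ {p} (f ∘ toℕ) (toℕ h)) δ))
                   (S-τ {p} {p} {f ∘ toℕ} (λ a → f≤p (toℕ a)) δ) ⟩
    S p (λ a → δ a * conj (conj f) a) + S p (J ∘ f)
      ≡⟨ cong (_+ S p (J ∘ f)) (S-cong {p} (λ a a<p → cong (δ a *_) (conj-involutive anti f≤p a<p))) ⟩
    S p (λ a → δ a * f a) + S p (J ∘ f)
      ≡⟨ +-comm (S p (λ a → δ a * f a)) (S p (J ∘ f)) ⟩
    S p (J ∘ f) + S p (λ a → δ a * f a)
      ≡⟨ ∑-distrib-+ {p} (λ a → J (f (toℕ a))) (λ a → δ (toℕ a) * f (toℕ a)) ⟨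
    colval J f ∎
    where open ≡-Reasoning

  conj-nested : ∀ {f} → NestedOptima f → NestedOptima (conj ∘ f)
  conj-nested {f} F = record
    { antitone = λ m → τ-antitone {p} (f m ∘ toℕ)
    ; bounded  = λ m → τ≤ {p} (f m ∘ toℕ)
    ; outside  = λ m → τ≡0 {p} (λ c → bounded m (toℕ c))
    ; total    = λ {m} m≤ → trans (sum-τ {p} {p} {f m ∘ toℕ} (λ c → bounded m (toℕ c))) (total m≤)
    ; nested   = λ m< → τ-mono {p} (λ c → nested m< (toℕ c))
    ; optimal  = λ {m} m≤ g g-anti g≤p eq →
        ≤-trans (optimal m≤ g g-anti g≤p eq) (≤-reflexive (sym (colval-conj (antitone m) (bounded m))))
    }
    where open NestedOptima F

  split-at : ∀ {a n} → a + n ≡ p → ∀ g → S p g ≡ S a g + S n (λ i → g (a + i))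
  split-at {a} {n} eq g = trans (cong (λ k → S k g) (sym eq)) (S-split a n g)

  module Lexicographic (2≤p : 2 ≤ p) (δ0 : δ 0 ≡ 0) (δ1 : δ 1 ≤ 1) (δ≥2 : ∀ {b} → 2 ≤ b → b < p → 2 ≤ δ b)
    (window : ∀ a j → a < p → a + j ≤ p → S j (λ i → δ (a + i)) ≤ j * δ a + J j) where

    J≡0 : ∀ {x} → x ≤ 1 → J x ≡ 0
    J≡0 z≤n       = refl
    J≡0 (s≤s z≤n) = trans (+-identityʳ (δ 0)) δ0

    J-suc : ∀ k → J (suc k) ≡ J k + δ k
    J-suc k = S-last k δ

    -- A window of length 2 gains at most `J 2` over `2 * δ a`, and two vertices span at most one
    -- edge.
    δ-suc : ∀ {a} → suc a < p → δ (suc a) ≤ δ a + 1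
    δ-suc {a} a<p = +-cancelˡ-≤ (δ a) (δ (suc a)) (δ a + 1) (begin
      δ a + δ (suc a)                ≡⟨ cong₂ (λ x y → δ x + δ y) (+-identityʳ a) (+-comm a 1) ⟨
      δ (a + 0) + δ (a + 1)          ≡⟨ cong (δ (a + 0) +_) (+-identityʳ (δ (a + 1))) ⟨
      S 2 (λ i → δ (a + i))          ≤⟨ window a 2 (<-trans (n<1+n a) a<p) (≤-trans (≤-reflexive (+-comm a 2)) a<p) ⟩
      2 * δ a + J 2                  ≤⟨ +-monoʳ-≤ (2 * δ a) J2≤1 ⟩
      2 * δ a + 1                    ≡⟨ regroup (δ a) ⟩
      δ a + (δ a + 1)                ∎)
      where
      open ≤-Reasoning
      J2≤1 : J 2 ≤ 1
      J2≤1 = ≤-trans (≤-reflexive (trans (cong (_+ (δ 1 + 0)) δ0) (+-identityʳ (δ 1)))) δ1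
      regroup : ∀ x → 2 * x + 1 ≡ x + (x + 1)
      regroup = solve-∀

    -- Columns of height at most 1 have no inner edges, so only the weights of the nonempty columns
    -- remain, and these come first.
    ones : ∀ n (e : ℕ → ℕ) {t} → Antitone t → t 0 ≤ 1 → S n (λ i → J (t i) + e i * t i) ≡ S (S n t) e
    ones n e {t} anti t0≤1 = trans
      (S-cong {n} (λ i i<n → cong₂ _+_ (J≡0 (t≤1 i)) (cong (e i *_) (sym (lt-count n {t} anti t≤1 i<n)))))
      (S-*lt n e (≤-trans (sum≤* {n} {1} (λ i → t≤1 (toℕ i))) (≤-reflexive (*-identityʳ n))))
      where
      t≤1 : ∀ i → t i ≤ 1
      t≤1 i = ≤-trans (anti z≤n) t0≤1

    module Follow {f : ℕ → ℕ → ℕ} (F : NestedOptima f) where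
      open NestedOptima F

      Prefix : ℕ → (ℕ → ℕ) → Set
      Prefix a g = ∀ c → c < a → g c ≡ p

      prefix-suc : ∀ {a m} → suc m ≤ p * p → Prefix a (f m) → Prefix a (f (suc m))
      prefix-suc {a} {m} m< pre c c<a =
        ≤-antisym (bounded (suc m) c) (≤-trans (≤-reflexive (sym (pre c c<a))) (nested m< c))

      S-prefix : ∀ {a g} → Prefix a g → S a g ≡ a * p
      S-prefix {a} pre = trans (S-cong {a} pre) (sum-const a p)

      tail-total : ∀ {a n k} → a + n ≡ p → a * p + k ≤ p * p → Prefix a (f (a * p + k)) →
                   S n (λ i → f (a * p + k) (a + i)) ≡ k
      tail-total {a} {n} {k} eq m≤ pre = +-cancelˡ-≡ (a * p) _ _ (begin
        a * p + S n (λ i → g (a + i))   ≡⟨ cong (_+ S n (λ i → g (a + i))) (S-prefix pre) ⟨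
        S a g + S n (λ i → g (a + i))   ≡⟨ split-at {a} {n} eq g ⟨
        S p g                           ≡⟨ total m≤ ⟩
        a * p + k                       ∎)
        where
        open ≡-Reasoning
        g = f (a * p + k)

      -- The share of the columns from `a` on. Sets with the same full prefix differ only in this
      -- part.
      tailval : ℕ → ℕ → (ℕ → ℕ) → ℕ
      tailval a n t = S n (λ i → J (t i) + δ (a + i) * t i)

      fill-prefix : ∀ a k → Prefix a (fill p (a * p + k))
      fill-prefix (suc a) k zero    _         = trans (cong (p ⊓_) (+-assoc p (a * p) k)) (m≤n⇒m⊓n≡m (m≤m+n p _))
      fill-prefix (suc a) k (suc c) (s≤s c<a) =
        trans (cong (λ x → fill p x (suc c)) (+-assoc p (a * p) k))
              (trans (fill-shift p (a * p + k) c) (fill-prefix a k c c<a))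

      fill-tail : ∀ a k i → fill p (a * p + k) (a + i) ≡ fill p k i
      fill-tail a k i = trans (fill-+ p (a * p + k) a i) (cong (λ x → fill p x i) (m+n∸m≡n (a * p) k))

      fill-small : ∀ {k} → k ≤ p → ∀ i → fill p k (suc i) ≡ 0
      fill-small k≤p i = trans (cong (λ x → fill p x i) (m≤n⇒m∸n≡0 k≤p)) (fill-0 p i)

      -- The competitor is the lexicographic set of the same size.
      tail-≥ : ∀ {a n k} → a + suc n ≡ p → a * p + k ≤ p * p → k ≤ p → Prefix a (f (a * p + k)) →
               J k + δ a * k ≤ tailval a (suc n) (λ i → f (a * p + k) (a + i))
      tail-≥ {a} {n} {k} eq m≤ k≤p pre = +-cancelˡ-≤ C _ _ (begin
        C + (J k + δ a * k)                      ≡⟨ cong (C +_) lex-tail ⟨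
        C + tailval a (suc n) (λ i → l (a + i))  ≡⟨ prefixed (fill-prefix a k) ⟨
        colval J l                               ≤⟨ optimal m≤ l (fill-antitone p _) (fill≤ p _) (S-fill {p} p m≤) ⟩
        colval J g                               ≡⟨ prefixed pre ⟩
        C + tailval a (suc n) (λ i → g (a + i))  ∎)
        where
        open ≤-Reasoning
        g = f (a * p + k)
        l = fill p (a * p + k)
        C = S a (λ c → J p + δ c * p)
        prefixed : ∀ {g} → Prefix a g → colval J g ≡ C + tailval a (suc n) (λ i → g (a + i))
        prefixed {g} pre = trans (split-at {a} {suc n} eq (λ c → J (g c) + δ c * g c))
          (cong (_+ tailval a (suc n) (λ i → g (a + i))) (S-cong {a} (λ c c<a → cong (λ x → J x + δ c * x) (pre c c<a))))
        l0 : l (a + 0) ≡ k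
        l0 = trans (fill-tail a k 0) (m≥n⇒m⊓n≡n k≤p)
        lex-tail : tailval a (suc n) (λ i → l (a + i)) ≡ J k + δ a * k
        lex-tail = trans
          (cong₂ _+_ (cong₂ (λ x y → J x + δ y * x) l0 (+-identityʳ a))
            (S-zero {n} (λ i _ → trans (cong (λ x → J x + δ (a + suc i) * x) (trans (fill-tail a k (suc i)) (fill-small k≤p i)))
                                       (*-zeroʳ (δ (a + suc i))))))
          (+-identityʳ _)

      in-square : ∀ {a k} → a < p → k ≤ p → a * p + k ≤ p * p
      in-square {a} {k} a<p k≤p = ≤-trans (+-monoʳ-≤ (a * p) k≤p)
        (≤-trans (≤-reflexive (+-comm (a * p) p)) (*-monoˡ-≤ p a<p))

      -- Once column a + 1 is opened while column a has height 1, column a never grows again: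
      -- the bound on windows makes every growth worse than the lexicographic set.
      stuck : ∀ {a n} → a + suc n ≡ p → Prefix a (f (a * p + 2)) → f (a * p + 2) a ≡ 1 →
              ∀ k → 2 + k ≤ p → Prefix a (f (a * p + (2 + k))) × f (a * p + (2 + k)) a ≡ 1
      stuck eq pre e zero    _ = pre , e
      stuck {a} {n} eq pre₂ e₂ (suc k) j<p with stuck eq pre₂ e₂ k (<⇒≤ j<p)
      ... | pre , e = pre′ , height (m≤n⇒m<n∨m≡n (subst (_≤ t′ 0) t0≡1 (t≤t′ 0)))
        where
        j = 2 + k
        a<p : a < p
        a<p = ≤-trans (m≤m+n (suc a) n) (≤-reflexive (trans (sym (+-suc a n)) eq))
        m≤ : a * p + j ≤ p * p
        m≤ = in-square a<p (<⇒≤ j<p)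
        m′≡ : a * p + suc j ≡ suc (a * p + j)
        m′≡ = +-suc (a * p) j
        m′≤ : a * p + suc j ≤ p * p
        m′≤ = in-square a<p j<p
        up : ∀ c → f (a * p + j) c ≤ f (a * p + suc j) c
        up c = subst (λ x → f (a * p + j) c ≤ f x c) (sym m′≡) (nested (subst (_≤ p * p) m′≡ m′≤) c)
        pre′ : Prefix a (f (a * p + suc j))
        pre′ = subst (λ x → Prefix a (f x)) (sym m′≡) (prefix-suc (subst (_≤ p * p) m′≡ m′≤) pre)
        t t′ : ℕ → ℕ
        t  i = f (a * p + j) (a + i)
        t′ i = f (a * p + suc j) (a + i)
        t≤t′ : ∀ i → t i ≤ t′ i
        t≤t′ i = up (a + i)
        t-antitone : Antitone t
        t-antitone i≤i′ = antitone _ (+-monoʳ-≤ a i≤i′)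
        t0≡1 : t 0 ≡ 1
        t0≡1 = trans (cong (f (a * p + j)) (+-identityʳ a)) e
        St : S (suc n) t ≡ j
        St = tail-total {a} {suc n} {j} eq m≤ pre
        St′ : S (suc n) t′ ≡ suc j
        St′ = tail-total {a} {suc n} {suc j} eq m′≤ pre′
        -- All tail columns have height at most 1, so `j` cells need at least `j` columns; this
        -- keeps the window below inside the grid.
        j≤n : j ≤ suc n
        j≤n = ≤-trans (≤-reflexive (sym St)) (≤-trans (sum≤* {suc n} {1} (λ i → ≤-trans (t-antitone {0} {toℕ i} z≤n) (≤-reflexive t0≡1)))
                (≤-reflexive (*-identityʳ (suc n))))
        rest rest′ : ℕ
        rest  = S n (t ∘ suc)
        rest′ = S n (t′ ∘ suc)
        rest-≡ : suc rest ≡ j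
        rest-≡ = trans (cong (_+ rest) (sym t0≡1)) St
        height : 1 < t′ 0 ⊎ 1 ≡ t′ 0 → f (a * p + suc j) a ≡ 1
        height (inj₂ e′) = trans (cong (f (a * p + suc j)) (sym (+-identityʳ a))) (sym e′)
        -- Growth of column `a` would force `δ j ≤ δ 1 ≤ 1`, although `2 ≤ j`.
        height (inj₁ 2≤) = contradiction (δ≥2 (s≤s (s≤s z≤n)) j<p) (<⇒≱ (s≤s (≤-trans δj≤δ1 δ1)))
          where
          rest≤ : rest ≤ rest′
          rest≤ = S-mono {n} (λ i _ → t≤t′ (suc i))
          t′0+ : t′ 0 + rest′ ≡ 2 + rest
          t′0+ = trans St′ (cong suc (sym rest-≡))
          -- Only one cell is added, so column `a` takes it and the other columns stay as they were.
          t′0≡2 : t′ 0 ≡ 2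
          t′0≡2 = ≤-antisym (+-cancelʳ-≤ rest (t′ 0) 2 (≤-trans (+-monoʳ-≤ (t′ 0) rest≤) (≤-reflexive t′0+))) 2≤
          same : ∀ {i} → i < n → t (suc i) ≡ t′ (suc i)
          same = S-tight {n} {t ∘ suc} {t′ ∘ suc} (t≤t′ ∘ suc)
            (sym (+-cancelˡ-≡ 2 rest′ rest (trans (cong (_+ rest′) (sym t′0≡2)) t′0+)))
          v : ℕ
          v = S n (λ i → J (t (suc i)) + δ (a + suc i) * t (suc i))
          val : δ a + v ≡ S j (λ i → δ (a + i))
          val = begin
            δ a + v                                          ≡⟨ cong (λ x → δ x + v) (+-identityʳ a) ⟨
            δ (a + 0) + v                                    ≡⟨ cong (_+ v) (*-identityʳ (δ (a + 0))) ⟨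
            δ (a + 0) * 1 + v                                ≡⟨ cong (λ x → x + δ (a + 0) * 1 + v) (J≡0 ≤-refl) ⟨
            J 1 + δ (a + 0) * 1 + v                          ≡⟨ cong (λ x → J x + δ (a + 0) * x + v) t0≡1 ⟨
            tailval a (suc n) t                              ≡⟨ ones (suc n) (λ i → δ (a + i)) {t} t-antitone (≤-reflexive t0≡1) ⟩
            S (S (suc n) t) (λ i → δ (a + i))                ≡⟨ cong (λ x → S x (λ i → δ (a + i))) St ⟩
            S j (λ i → δ (a + i))                            ∎
            where open ≡-Reasoning
          val′ : tailval a (suc n) t′ ≡ δ 1 + δ a + (δ a + v)
          val′ = begin
            tailval a (suc n) t′                             ≡⟨ cong₂ _+_ (cong₂ (λ x y → J x + δ y * x) t′0≡2 (+-identityʳ a))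
                                                                  (S-cong {n} (λ i i<n → cong (λ x → J x + δ (a + suc i) * x) (sym (same i<n)))) ⟩
            J 2 + δ a * 2 + v                                ≡⟨ cong (λ x → x + (δ 1 + 0) + δ a * 2 + v) δ0 ⟩
            0 + (δ 1 + 0) + δ a * 2 + v                      ≡⟨ regroup (δ 1) (δ a) v ⟩
            δ 1 + δ a + (δ a + v)                            ∎
            where
            open ≡-Reasoning
            regroup : ∀ x y z → 0 + (x + 0) + y * 2 + z ≡ x + y + (y + z)
            regroup = solve-∀
          -- The lexicographic tail is worth `J (suc j) + δ a * suc j`. The actual one is a window
          -- of length `j` plus `δ 1 + δ a` for the second cell of column `a`, and `window` bounds
          -- the former.
          δj≤δ1 : δ j ≤ δ 1
          δj≤δ1 = +-cancelʳ-≤ (δ a + (j * δ a + J j)) (δ j) (δ 1) (begin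
            δ j + (δ a + (j * δ a + J j))                    ≡⟨ lhs (δ j) (δ a) j (J j) ⟩
            J j + δ j + δ a * suc j                          ≡⟨ cong (_+ δ a * suc j) (J-suc j) ⟨
            J (suc j) + δ a * suc j                          ≤⟨ tail-≥ {a} {n} {suc j} eq m′≤ j<p pre′ ⟩
            tailval a (suc n) t′                             ≡⟨ val′ ⟩
            δ 1 + δ a + (δ a + v)                            ≡⟨ cong (δ 1 + δ a +_) val ⟩
            δ 1 + δ a + S j (λ i → δ (a + i))                ≤⟨ +-monoʳ-≤ (δ 1 + δ a) (window a j a<p (≤-trans (+-monoʳ-≤ a j≤n) (≤-reflexive eq))) ⟩
            δ 1 + δ a + (j * δ a + J j)                      ≡⟨ +-assoc (δ 1) (δ a) _ ⟩
            δ 1 + (δ a + (j * δ a + J j))                    ∎)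
            where
            open ≤-Reasoning
            lhs : ∀ x y j z → x + (y + (j * y + z)) ≡ z + x + y * suc j
            lhs = solve-∀

      -- Induction on `m = a * p + b`: the chain has `a` full columns and `b` cells in column `a`.
      -- The next cell must go to column `a`, and the resulting shape is recognised by
      -- `fill-unique`.
      follows : f 2 0 ≡ 2 → ∀ m → m ≤ p * p → ∀ c → f m c ≡ fill p m c
      follows f20 zero m≤ c with c <? p
      ... | yes c<p = trans (S≡0 {p} (f 0) (total z≤n) c<p) (sym (fill-0 p c))
      ... | no  c≮p = trans (outside 0 (≮⇒≥ c≮p)) (sym (fill-0 p c))
      follows f20 (suc m) m< c = trans (sym (fill-unique {p} p a (f (suc m)) pre′ (bounded (suc m) a) zeros a<p c))
                                       (cong (λ x → fill p x c) (total m<))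
        where
        instance
          p≢0 : NonZero p
          p≢0 = >-nonZero (≤-trans (s≤s z≤n) 2≤p)
        a = m / p
        b = m % p
        b<p : b < p
        b<p = m%n<n m p
        m≡ : m ≡ a * p + b
        m≡ = trans (m≡m%n+[m/n]*n m p) (+-comm b (a * p))
        m′≡ : suc m ≡ a * p + suc b
        m′≡ = trans (cong suc m≡) (sym (+-suc (a * p) b))
        a<p : a < p
        a<p = m<n*o⇒m/o<n m<
        n = p ∸ suc a
        eq : a + suc n ≡ p
        eq = trans (+-suc a n) (m+[n∸m]≡n a<p)
        IH : ∀ c → f m c ≡ fill p m c
        IH = follows f20 m (<⇒≤ m<)
        pre′ : Prefix a (f (suc m))
        pre′ = prefix-suc m< (λ c c<a → trans (IH c) (trans (cong (λ x → fill p x c) m≡) (fill-prefix a b c c<a)))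
        height : f m a ≡ b
        height = trans (IH a) (trans (cong₂ (fill p) m≡ (sym (+-identityʳ a))) (trans (fill-tail a b 0) (m≥n⇒m⊓n≡n (<⇒≤ b<p))))
        t : ℕ → ℕ
        t i = f (suc m) (a + i)
        t-antitone : Antitone t
        t-antitone i≤j = antitone _ (+-monoʳ-≤ a i≤j)
        b≤t0 : b ≤ t 0
        b≤t0 = subst₂ _≤_ height (cong (f (suc m)) (sym (+-identityʳ a))) (nested m< a)
        St : S (suc n) t ≡ suc b
        St = trans (S-cong {suc n} (λ i _ → cong (λ x → f x (a + i)) m′≡))
          (tail-total {a} {suc n} {suc b} eq (subst (_≤ p * p) m′≡ m<) (subst (λ x → Prefix a (f x)) m′≡ pre′))
        rest = S n (t ∘ suc)
        -- Otherwise the new cell opens column `suc a`, which is then of height 1.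
        grows : t 0 ≢ b
        grows t0≡b = impossible a refl
          where
          rest≡1 : rest ≡ 1
          rest≡1 = +-cancelˡ-≡ b rest 1 (trans (cong (_+ rest) (sym t0≡b)) (trans St (+-comm 1 b)))
          0<n : 0 < n
          0<n = n≢0⇒n>0 (λ n≡0 → contradiction (trans (sym rest≡1) (cong (λ x → S x (t ∘ suc)) n≡0)) λ ())
          t1≤1 : t 1 ≤ 1
          t1≤1 = ≤-trans (S-term {n} (t ∘ suc) 0<n) (≤-reflexive rest≡1)
          sa<p : suc a < p
          sa<p = ≤-trans (+-monoʳ-≤ 2 (≤-reflexive (sym (+-identityʳ a))))
                   (≤-trans (≤-reflexive (+-comm 2 (a + 0))) (≤-trans (≤-reflexive (cong (_+ 2) (+-identityʳ a))) (≤-trans (+-monoʳ-≤ a (s≤s 0<n)) (≤-reflexive eq))))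
          1≤t1 : 1 ≤ t 1
          1≤t1 = n≢0⇒n>0 (λ t1≡0 → contradiction (trans (sym rest≡1)
                   (S-zero {n} (λ i _ → n≤0⇒n≡0 (≤-trans (t-antitone {1} {suc i} (s≤s z≤n)) (≤-reflexive t1≡0))))) λ ())
          -- Continuing column `a` would gain `δ a + δ b`, opening the next one gains
          -- `δ (suc a) ≤ δ a + 1`. With `δ≥2` this leaves only `b ≡ 1`, since `b` is at least the
          -- height of column `suc a`.
          δb≤1 : δ b ≤ 1
          δb≤1 = +-cancelˡ-≤ (J b + δ a * b + δ a) (δ b) 1 (begin
            J b + δ a * b + δ a + δ b               ≡⟨ lhs (J b) (δ a) b (δ b) ⟩
            J b + δ b + δ a * suc b                 ≡⟨ cong (_+ δ a * suc b) (J-suc b) ⟨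
            J (suc b) + δ a * suc b                 ≤⟨ tail-≥ {a} {n} {suc b} eq (subst (_≤ p * p) m′≡ m<) b<p (subst (λ x → Prefix a (f x)) m′≡ pre′) ⟩
            tailval a (suc n) (λ i → f (a * p + suc b) (a + i))
                                                    ≡⟨ S-cong {suc n} (λ i _ → cong (λ x → J (f x (a + i)) + δ (a + i) * f x (a + i)) m′≡) ⟨
            tailval a (suc n) t                     ≡⟨ cong₂ _+_ (cong₂ (λ x y → J x + δ y * x) t0≡b (+-identityʳ a))
                                                         (ones n (λ i → δ (a + suc i)) {t ∘ suc} (t-antitone ∘ s≤s) t1≤1) ⟩
            J b + δ a * b + S rest (λ i → δ (a + suc i)) ≡⟨ cong (λ x → J b + δ a * b + S x (λ i → δ (a + suc i))) rest≡1 ⟩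
            J b + δ a * b + (δ (a + 1) + 0)         ≡⟨ cong (J b + δ a * b +_) (trans (+-identityʳ _) (cong δ (+-comm a 1))) ⟩
            J b + δ a * b + δ (suc a)               ≤⟨ +-monoʳ-≤ (J b + δ a * b) (δ-suc sa<p) ⟩
            J b + δ a * b + (δ a + 1)               ≡⟨ +-assoc (J b + δ a * b) (δ a) 1 ⟨
            J b + δ a * b + δ a + 1                 ∎)
            where
            open ≤-Reasoning
            lhs : ∀ x y b z → x + y * b + y + z ≡ x + z + y * suc b
            lhs = solve-∀
          b≡1 : b ≡ 1
          b≡1 = ≤-antisym (s≤s⁻¹ (≰⇒> (λ 2≤b → <⇒≱ (δ≥2 2≤b b<p) δb≤1)))
                  (≤-trans 1≤t1 (≤-trans (t-antitone z≤n) (≤-reflexive t0≡b)))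
          fa≡1 : f (suc m) a ≡ 1
          fa≡1 = trans (cong (f (suc m)) (sym (+-identityʳ a))) (trans t0≡b b≡1)
          m″≡ : suc m ≡ a * p + 2
          m″≡ = trans m′≡ (cong (λ x → a * p + suc x) b≡1)
          -- For `a ≡ 0` the set has two cells, against `f20`. Otherwise `stuck` keeps column `a` at
          -- height 1 up to size `a * p + p`, and the `p` cells beyond the full columns do not fit
          -- into fewer than `p` columns of height at most 1.
          impossible : ∀ a′ → a ≡ a′ → ⊥
          impossible zero a≡0 = contradiction
            (trans (sym f20) (trans (cong₂ f (sym (trans m″≡ (cong (λ x → x * p + 2) a≡0))) (sym a≡0)) fa≡1)) λ ()
          impossible (suc a′) a≡ = <⇒≱ n<p (begin
            p                                               ≡⟨ tail-total {a} {suc n} {p} eq (in-square a<p ≤-refl) (proj₁ end) ⟨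
            S (suc n) (λ i → f (a * p + p) (a + i))         ≤⟨ sum≤* {suc n} {1} (λ i → ≤-trans (antitone _ (m≤m+n a (toℕ i))) (≤-reflexive (proj₂ end))) ⟩
            suc n * 1                                       ≡⟨ *-identityʳ (suc n) ⟩
            suc n                                           ∎)
            where
            open ≤-Reasoning
            end : Prefix a (f (a * p + p)) × f (a * p + p) a ≡ 1
            end = subst (λ x → Prefix a (f (a * p + x)) × f (a * p + x) a ≡ 1) (m+[n∸m]≡n 2≤p)
                    (stuck eq (subst (λ x → Prefix a (f x)) m″≡ pre′) (subst (λ x → f x a ≡ 1) m″≡ fa≡1)
                      (p ∸ 2) (≤-reflexive (m+[n∸m]≡n 2≤p)))
            n<p : suc n < p
            n<p = ≤-trans (+-monoˡ-≤ (suc n) {1} {a} (≤-trans (s≤s z≤n) (≤-reflexive (sym a≡)))) (≤-reflexive eq)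
        rest≡0 : rest ≡ 0
        rest≡0 = n≤0⇒n≡0 (+-cancelˡ-≤ (suc b) rest 0 (≤-trans (+-monoˡ-≤ rest (≤∧≢⇒< b≤t0 (grows ∘ sym)))
                   (≤-reflexive (trans St (sym (+-identityʳ (suc b)))))))
        zeros : ∀ c → a < c → f (suc m) c ≡ 0
        zeros c a<c with c <? p
        ... | no  c≮p = outside (suc m) (≮⇒≥ c≮p)
        ... | yes c<p = trans (cong (f (suc m)) (sym c≡)) (S≡0 {n} (t ∘ suc) rest≡0 j<n)
          where
          j = c ∸ suc a
          c≡ : a + suc j ≡ c
          c≡ = trans (+-suc a j) (m+[n∸m]≡n a<c)
          j<n : j < n
          j<n = s≤s⁻¹ (+-cancelˡ-< a (suc j) (suc n) (subst₂ _<_ (sym c≡) (sym eq) c<p))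

      2≤pp : 2 ≤ p * p
      2≤pp = ≤-trans (s≤s (s≤s z≤n)) (*-mono-≤ 2≤p 2≤p)

      -- Two cells of a staircase lie in one column or in one row.
      start : f 2 0 ≡ 2 ⊎ conj (f 2) 0 ≡ 2
      start with m≤n⇒m<n∨m≡n (≤-trans (S-term {p} (f 2) (≤-trans (s≤s z≤n) 2≤p)) (≤-reflexive (total 2≤pp)))
      ... | inj₂ e  = inj₁ e
      ... | inj₁ lt = inj₂ (trans (S-cong {p} (λ c _ → lt-0 (≤-trans (antitone 2 {0} {c} z≤n) (s≤s⁻¹ lt)))) (total 2≤pp))

    -- After a transposition if necessary, the chain consists of the lexicographic sets themselves,
    -- so these inherit its optimality.
    lex-optimal : ∀ {f} → NestedOptima f → OPT J p
    lex-optimal {f} F g anti g≤p with Follow.start F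
    ... | inj₁ e = ≤-trans (NestedOptima.optimal F m≤ g anti g≤p refl)
                     (≤-reflexive (S-cong {p} (λ c _ → cong (λ x → J x + δ c * x) (Follow.follows F e (S p g) m≤ c))))
      where
      m≤ : S p g ≤ p * p
      m≤ = sum≤* {p} (λ i → g≤p (toℕ i))
    ... | inj₂ e = ≤-trans (NestedOptima.optimal F′ m≤ g anti g≤p refl)
                     (≤-reflexive (S-cong {p} (λ c _ → cong (λ x → J x + δ c * x) (Follow.follows F′ e (S p g) m≤ c))))
      where
      F′ = conj-nested F
      m≤ : S p g ≤ p * p
      m≤ = sum≤* {p} (λ i → g≤p (toℕ i))

-- Edge counting and nested solutions

sumᴸ-tabulate : ∀ {n} (h : Fin n → ℕ) → sumᴸ (List.tabulate h) ≡ sum h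
sumᴸ-tabulate {zero}  h = refl
sumᴸ-tabulate {suc n} h = cong (h zero +_) (sumᴸ-tabulate (h ∘ suc))

sumᴸ-allFin : ∀ {n} (h : Fin n → ℕ) → sumᴸ (map h (allFin n)) ≡ sum h
sumᴸ-allFin h = trans (cong sumᴸ (map-tabulate id h)) (sumᴸ-tabulate h)

sumᴸ-concatMap : ∀ {A : Set} (f : A → List ℕ) xs → sumᴸ (concatMap f xs) ≡ sumᴸ (map (sumᴸ ∘ f) xs)
sumᴸ-concatMap f []       = refl
sumᴸ-concatMap f (x ∷ xs) = trans (sum-++ (f x) (concatMap f xs)) (cong (sumᴸ (f x) +_) (sumᴸ-concatMap f xs))

module _ (G : Graph) where

  a : Fin (order G) → Fin (order G) → ℕ
  a i j = ⟦ adj G i j ⟧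

  deg : (Fin (order G) → ℕ) → Fin (order G) → ℕ
  deg x i = ∑[ j < order G ] (a i j * x j)

  B : (x y : Fin (order G) → ℕ) → ℕ
  B x y = ∑[ i < order G ] (x i * deg y i)

  -- The quadratic form of the adjacency matrix. On an indicator it counts ordered adjacent pairs,
  -- twice the number of edges, and it is free of the order on vertices used in `edgesIn`.
  Q : (Fin (order G) → ℕ) → ℕ
  Q x = B x x

χ : ∀ {n} → (Fin n → Bool) → Fin n → ℕ
χ s i = ⟦ s i ⟧

sum-cong₂ : ∀ {m n} {f g : Fin m → Fin n → ℕ} → (∀ i j → f i j ≡ g i j) →
            ∑[ i < m ] ∑[ j < n ] f i j ≡ ∑[ i < m ] ∑[ j < n ] g i j
sum-cong₂ {m} {n} e = sum-cong-≗ {m} (λ i → sum-cong-≗ {n} (e i))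

Q-terms : ∀ G x y → B G x y ≡ ∑[ i < order G ] ∑[ j < order G ] (x i * (a G i j * y j))
Q-terms G x y = sum-cong-≗ {order G} (λ i → *-distribˡ-sum {order G} (x i) (λ j → a G i j * y j))

lt-flip : ∀ i j → lt i (suc j) + lt j i ≡ 1
lt-flip zero    j       = refl
lt-flip (suc i) zero    = refl
lt-flip (suc i) (suc j) = lt-flip i j

lt-trichotomy : ∀ i j → i ≢ j → lt i j + lt j i ≡ 1
lt-trichotomy zero    zero    i≢j = contradiction refl i≢j
lt-trichotomy zero    (suc j) _   = refl
lt-trichotomy (suc i) zero    _   = refl
lt-trichotomy (suc i) (suc j) i≢j = lt-trichotomy i j (i≢j ∘ cong suc)

⟦∧⟧ : ∀ b c → ⟦ b ∧ c ⟧ ≡ ⟦ b ⟧ * ⟦ c ⟧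
⟦∧⟧ true  c = sym (+-identityʳ ⟦ c ⟧)
⟦∧⟧ false c = refl

edgesIn-Q : ∀ {G} → Simple G → ∀ A → 2 * edgesIn G A ≡ Q G (χ (lookup A))
edgesIn-Q {G} (adj-sym , adj-irrefl) A = begin
  2 * edgesIn G A                     ≡⟨ cong (2 *_) edges ⟩
  2 * half                            ≡⟨ cong (half +_) (+-identityʳ half) ⟩
  half + half                         ≡⟨ cong (half +_) swap ⟩
  half + ∑[ i < n ] ∑[ j < n ] (lt (toℕ j) (toℕ i) * t i j)
    ≡⟨ ∑-distrib-+ {n} (λ i → ∑[ j < n ] (lt (toℕ i) (toℕ j) * t i j)) (λ i → ∑[ j < n ] (lt (toℕ j) (toℕ i) * t i j)) ⟨
  ∑[ i < n ] (∑[ j < n ] (lt (toℕ i) (toℕ j) * t i j) + ∑[ j < n ] (lt (toℕ j) (toℕ i) * t i j))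
    ≡⟨ sum-cong-≗ {n} (λ i → ∑-distrib-+ {n} (λ j → lt (toℕ i) (toℕ j) * t i j) (λ j → lt (toℕ j) (toℕ i) * t i j)) ⟨
  ∑[ i < n ] ∑[ j < n ] (lt (toℕ i) (toℕ j) * t i j + lt (toℕ j) (toℕ i) * t i j)
    ≡⟨ sum-cong₂ {n} {n} whole ⟩
  ∑[ i < n ] ∑[ j < n ] t i j         ≡⟨ Q-terms G x x ⟨
  Q G x                               ∎
  where
  open ≡-Reasoning
  n = order G
  x = χ (lookup A)
  t : Fin n → Fin n → ℕ
  t i j = x i * (a G i j * x j)
  half = ∑[ i < n ] ∑[ j < n ] (lt (toℕ i) (toℕ j) * t i j)
  t-sym : ∀ i j → t i j ≡ t j i
  t-sym i j = trans (cong (λ b → x i * (⟦ b ⟧ * x j)) (adj-sym i j)) (regroup (x i) (a G j i) (x j))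
    where
    regroup : ∀ x y z → x * (y * z) ≡ z * (y * x)
    regroup = solve-∀
  edge : Fin n → Fin n → ℕ
  edge i j = if ⌊ toℕ i <? toℕ j ⌋ ∧ lookup A i ∧ lookup A j ∧ adj G i j then 1 else 0
  edge-≡ : ∀ i j → edge i j ≡ lt (toℕ i) (toℕ j) * t i j
  edge-≡ i j with toℕ i <? toℕ j
  ... | no  i≮j rewrite lt≡0 (≮⇒≥ i≮j) = refl
  ... | yes i<j rewrite lt≡1 i<j = trans (ind (lookup A i ∧ lookup A j ∧ adj G i j))
    (trans (trans (⟦∧⟧ (lookup A i) _) (cong (x i *_) (trans (⟦∧⟧ (lookup A j) _) (*-comm (x j) _)))) (sym (+-identityʳ (t i j))))
    where
    ind : ∀ b → (if b then 1 else 0) ≡ ⟦ b ⟧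
    ind true  = refl
    ind false = refl
  edges : edgesIn G A ≡ half
  edges = begin
    edgesIn G A                                              ≡⟨ sumᴸ-concatMap (λ i → map (edge i) (allFin n)) (allFin n) ⟩
    sumᴸ (map (λ i → sumᴸ (map (edge i) (allFin n))) (allFin n)) ≡⟨ sumᴸ-allFin (λ i → sumᴸ (map (edge i) (allFin n))) ⟩
    ∑[ i < n ] sumᴸ (map (edge i) (allFin n))                ≡⟨ sum-cong-≗ {n} (λ i → trans (sumᴸ-allFin (edge i)) (sum-cong-≗ {n} (edge-≡ i))) ⟩
    half                                                     ∎
  swap : half ≡ ∑[ i < n ] ∑[ j < n ] (lt (toℕ j) (toℕ i) * t i j)
  swap = trans (∑-comm {n} {n} (λ i j → lt (toℕ i) (toℕ j) * t i j))
    (sum-cong₂ {n} {n} (λ j i → cong (lt (toℕ i) (toℕ j) *_) (t-sym i j)))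
  whole : ∀ i j → lt (toℕ i) (toℕ j) * t i j + lt (toℕ j) (toℕ i) * t i j ≡ t i j
  whole i j with i ≟ᶠ j
  ... | yes refl rewrite adj-irrefl i | *-zeroʳ (x i) | *-zeroʳ (lt (toℕ i) (toℕ i)) = refl
  ... | no  i≢j  = trans (sym (*-distribʳ-+ (t i j) (lt (toℕ i) (toℕ j)) (lt (toℕ j) (toℕ i))))
    (trans (cong (_* t i j) (lt-trichotomy (toℕ i) (toℕ j) (i≢j ∘ toℕ-injective))) (+-identityʳ (t i j)))

∣∣-sum : ∀ {n} (A : Subset n) → ∣ A ∣ ≡ sum (χ (lookup A))
∣∣-sum []          = refl
∣∣-sum (true  ∷ A) = cong suc (∣∣-sum A)
∣∣-sum (false ∷ A) = ∣∣-sum A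

∈-allSubsets : ∀ {n} (A : Subset n) → A ∈ allSubsets n
∈-allSubsets [] = here refl
∈-allSubsets {suc n} (true  ∷ A) = ∈-++⁺ˡ (∈-map⁺ (true ∷_) (∈-allSubsets A))
∈-allSubsets {suc n} (false ∷ A) = ∈-++⁺ʳ (map (true ∷_) (allSubsets n)) (∈-map⁺ (false ∷_) (∈-allSubsets A))

≤-max : ∀ {x} {xs : List ℕ} → x ∈ xs → x ≤ foldr _⊔_ 0 xs
≤-max (here refl) = m≤m⊔n _ _
≤-max (there x∈)  = ≤-trans (≤-max x∈) (m≤n⊔m _ _)

max-≤ : ∀ {A : Set} (f : A → ℕ) (xs : List A) {b} → (∀ {x} → x ∈ xs → f x ≤ b) → foldr _⊔_ 0 (map f xs) ≤ b
max-≤ f []       _ = z≤n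
max-≤ f (x ∷ xs) h = ⊔-lub (h (here refl)) (max-≤ f xs (h ∘ there))

edgesIn≤I : ∀ G {m} A → ∣ A ∣ ≡ m → edgesIn G A ≤ I G m
edgesIn≤I G {m} A eq = ≤-max (∈-map⁺ (edgesIn G) (∈-filter⁺ (λ A → ∣ A ∣ ≟ m) (∈-allSubsets A) eq))

I≤ : ∀ G {m b} → (∀ A → ∣ A ∣ ≡ m → edgesIn G A ≤ b) → I G m ≤ b
I≤ G {m} h = max-≤ (edgesIn G) (filter (λ A → ∣ A ∣ ≟ m) (allSubsets (order G)))
  (λ {A} A∈ → h A (proj₂ (∈-filter⁻ (λ A → ∣ A ∣ ≟ m) {xs = allSubsets (order G)} A∈)))

χ-tabulate : ∀ {n} (s : Fin n → Bool) → sum (χ (lookup (tabulate s))) ≡ sum (χ s)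
χ-tabulate {n} s = sum-cong-≗ {n} (λ i → cong ⟦_⟧ (lookup∘tabulate s i))

B-cong : ∀ G {x x′ y y′} → (∀ i → x i ≡ x′ i) → (∀ i → y i ≡ y′ i) → B G x y ≡ B G x′ y′
B-cong G ex ey = sum-cong-≗ {order G} (λ i → cong₂ _*_ (ex i) (sum-cong-≗ {order G} (λ j → cong (a G i j *_) (ey j))))

Q-cong : ∀ G {x y} → (∀ i → x i ≡ y i) → Q G x ≡ Q G y
Q-cong G e = B-cong G e e

Q-mono : ∀ G {x y} → (∀ i → x i ≤ y i) → Q G x ≤ Q G y
Q-mono G e = sum-mono {order G} (λ i → *-mono-≤ (e i) (sum-mono {order G} (λ j → *-monoʳ-≤ (a G i j) (e j))))

edgesIn-tabulate : ∀ {G} → Simple G → ∀ s → 2 * edgesIn G (tabulate s) ≡ Q G (χ s)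
edgesIn-tabulate {G} simple s = trans (edgesIn-Q {G} simple (tabulate s)) (Q-cong G (λ i → cong ⟦_⟧ (lookup∘tabulate s i)))

Q≤I : ∀ {G} → Simple G → ∀ s {m} → sum (χ s) ≡ m → Q G (χ s) ≤ 2 * I G m
Q≤I {G} simple s eq = ≤-trans (≤-reflexive (sym (edgesIn-tabulate {G} simple s)))
  (*-monoʳ-≤ 2 (edgesIn≤I G (tabulate s) (trans (∣∣-sum (tabulate s)) (trans (χ-tabulate s) eq))))

-- Nested solutions, continued constantly beyond the order of the graph so that monotonicity is unconditional.
record Nest (G : Graph) : Set where
  field
    set  : ℕ → Fin (order G) → Bool
    size : ∀ {k} → k ≤ order G → sum (χ (set k)) ≡ k
    best : ∀ {k} → k ≤ order G → Q G (χ (set k)) ≡ 2 * I G k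
    grow : ∀ {j k} → j ≤ k → ∀ i → χ (set j) i ≤ χ (set k) i

⊆⇒χ≤ : ∀ {n} {A A′ : Subset n} → A ⊆ A′ → ∀ i → χ (lookup A) i ≤ χ (lookup A′) i
⊆⇒χ≤ {A = A} {A′} A⊆A′ i with lookup A i in eq
... | false = z≤n
... | true  = ≤-reflexive (cong ⟦_⟧ (sym ([]=⇒lookup (A⊆A′ (lookup⇒[]= i A eq)))))

χ≤⇒⊆ : ∀ {n} (s s′ : Fin n → Bool) → (∀ i → χ s i ≤ χ s′ i) → tabulate s ⊆ tabulate s′
χ≤⇒⊆ s s′ le {i} i∈ = lookup⇒[]= i (tabulate s′) (trans (lookup∘tabulate s′ i) (true′ (le i)))
  where
  s-true : s i ≡ true
  s-true = trans (sym (lookup∘tabulate s i)) ([]=⇒lookup i∈)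
  true′ : ⟦ s i ⟧ ≤ ⟦ s′ i ⟧ → s′ i ≡ true
  true′ h with s′ i
  ... | true  = refl
  ... | false = contradiction (≤-trans (≤-reflexive (sym (cong ⟦_⟧ s-true))) h) λ ()

nest : ∀ {G} → Simple G → NestedSolutions G → Nest G
nest {G} simple (A , optimal , nested) = record
  { set  = λ k → lookup (A (k ⊓ p))
  ; size = λ {k} k≤p → subst (λ j → sum (χ (lookup (A j))) ≡ k) (sym (m≤n⇒m⊓n≡m k≤p))
             (trans (sym (∣∣-sum (A k))) (proj₁ (optimal k k≤p)))
  ; best = λ {k} k≤p → subst (λ j → Q G (χ (lookup (A j))) ≡ 2 * I G k) (sym (m≤n⇒m⊓n≡m k≤p))
             (trans (sym (edgesIn-Q {G} simple (A k))) (cong (2 *_) (proj₂ (optimal k k≤p))))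
  ; grow = λ j≤k → mono (⊓-monoˡ-≤ p j≤k) (m⊓n≤n _ p)
  }
  where
  p = order G
  mono : ∀ {j k} → j ≤ k → k ≤ p → ∀ i → χ (lookup (A j)) i ≤ χ (lookup (A k)) i
  mono {k = zero}  z≤n _   i = ≤-refl
  mono {j} {suc k} j≤ k≤p i with m≤n⇒m<n∨m≡n j≤
  ... | inj₂ refl = ≤-refl
  ... | inj₁ j<k  = ≤-trans (mono (s≤s⁻¹ j<k) (<⇒≤ k≤p) i) (⊆⇒χ≤ (nested k k≤p) i)

-- An increasing chain that attains an upper bound `v` is optimal and identifies `I G` with `v`; the
-- induction needs both conclusions.
unnest : ∀ {G} → Simple G → (s : ℕ → Fin (order G) → Bool) (v : ℕ → ℕ) →
  (∀ {m} → m ≤ order G → sum (χ (s m)) ≡ m) → (∀ m → Q G (χ (s m)) ≡ 2 * v m) →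
  (∀ {m} → m ≤ order G → I G m ≤ v m) → (∀ m i → χ (s m) i ≤ χ (s (suc m)) i) →
  NestedSolutions G × (∀ {m} → m ≤ order G → I G m ≡ v m)
unnest {G} simple s v size value upper grow =
  (tabulate ∘ s , (λ m m≤ → card m≤ , trans (edges m) (sym (exact m≤))) , (λ m _ → χ≤⇒⊆ (s m) (s (suc m)) (grow m)))
  , exact
  where
  card : ∀ {m} → m ≤ order G → ∣ tabulate (s m) ∣ ≡ m
  card {m} m≤ = trans (∣∣-sum (tabulate (s m))) (trans (χ-tabulate (s m)) (size m≤))
  edges : ∀ m → edgesIn G (tabulate (s m)) ≡ v m
  edges m = *-cancelˡ-≡ _ _ 2 (trans (edgesIn-tabulate {G} simple (s m)) (value m))
  exact : ∀ {m} → m ≤ order G → I G m ≡ v m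
  exact {m} m≤ = ≤-antisym (upper m≤) (≤-trans (≤-reflexive (sym (edges m))) (edgesIn≤I G (tabulate (s m)) (card m≤)))

-- The δ-sequence of a graph with nested solutions

≟-ind : ∀ {n} (i j : Fin n) → ℕ
≟-ind i j = ⟦ ⌊ i ≟ᶠ j ⌋ ⟧

≟-suc : ∀ {n} (i j : Fin n) → ≟-ind (suc i) (suc j) ≡ ≟-ind i j
≟-suc i j with i ≟ᶠ j
... | yes _ = refl
... | no  _ = refl

sum-≟ : ∀ {n} (i : Fin n) (g : Fin n → ℕ) → ∑[ j < n ] (≟-ind i j * g j) ≡ g i
sum-≟ {suc n} zero    g = trans (cong₂ _+_ (+-identityʳ (g zero)) (sum-zero {n} (λ _ → refl))) (+-identityʳ (g zero))
sum-≟ {suc n} (suc i) g = trans (sum-cong-≗ {n} (λ j → cong (_* g (suc j)) (≟-suc i j))) (sum-≟ i (g ∘ suc))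

deg-+ : ∀ G x y i → deg G (λ j → x j + y j) i ≡ deg G x i + deg G y i
deg-+ G x y i = trans (sum-cong-≗ {order G} (λ j → *-distribˡ-+ (a G i j) (x j) (y j)))
  (∑-distrib-+ {order G} (λ j → a G i j * x j) (λ j → a G i j * y j))

B-comm : ∀ {G} → Simple G → ∀ x y → B G x y ≡ B G y x
B-comm {G} (adj-sym , _) x y = begin
  B G x y                                                              ≡⟨ Q-terms G x y ⟩
  ∑[ i < order G ] ∑[ j < order G ] (x i * (a G i j * y j))            ≡⟨ ∑-comm {order G} {order G} (λ i j → x i * (a G i j * y j)) ⟩
  ∑[ j < order G ] ∑[ i < order G ] (x i * (a G i j * y j))            ≡⟨ sum-cong₂ {order G} {order G} (λ j i →
    trans (cong (λ b → x i * (⟦ b ⟧ * y j)) (adj-sym i j)) (regroup (x i) (a G j i) (y j))) ⟩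
  ∑[ j < order G ] ∑[ i < order G ] (y j * (a G j i * x i))            ≡⟨ Q-terms G y x ⟨
  B G y x                                                              ∎
  where
  open ≡-Reasoning
  regroup : ∀ x y z → x * (y * z) ≡ z * (y * x)
  regroup = solve-∀

Q-+ : ∀ {G} → Simple G → ∀ x y → Q G (λ i → x i + y i) ≡ Q G x + 2 * B G y x + Q G y
Q-+ {G} simple x y = begin
  Q G (λ i → x i + y i)
    ≡⟨ sum-cong-≗ {p} (λ i → trans (cong ((x i + y i) *_) (deg-+ G x y i)) (expand (x i) (y i) (deg G x i) (deg G y i))) ⟩
  ∑[ i < p ] ((x i * deg G x i + x i * deg G y i) + (y i * deg G x i + y i * deg G y i))
    ≡⟨ ∑-distrib-+ {p} (λ i → x i * deg G x i + x i * deg G y i) (λ i → y i * deg G x i + y i * deg G y i) ⟩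
  ∑[ i < p ] (x i * deg G x i + x i * deg G y i) + ∑[ i < p ] (y i * deg G x i + y i * deg G y i)
    ≡⟨ cong₂ _+_ (∑-distrib-+ {p} (λ i → x i * deg G x i) (λ i → x i * deg G y i)) (∑-distrib-+ {p} (λ i → y i * deg G x i) (λ i → y i * deg G y i)) ⟩
  (Q G x + B G x y) + (B G y x + Q G y)
    ≡⟨ cong (λ k → (Q G x + k) + (B G y x + Q G y)) (B-comm {G} simple x y) ⟩
  (Q G x + B G y x) + (B G y x + Q G y)
    ≡⟨ collect (Q G x) (B G y x) (Q G y) ⟩
  Q G x + 2 * B G y x + Q G y ∎
  where
  open ≡-Reasoning
  p = order G
  expand : ∀ x y u v → (x + y) * (u + v) ≡ (x * u + x * v) + (y * u + y * v)
  expand = solve-∀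
  collect : ∀ a b c → (a + b) + (b + c) ≡ a + 2 * b + c
  collect = solve-∀

-- Twice the bound k(k - 1)/2 on the edges of a k-set, written without subtraction. A vertex is not
-- its own neighbour, so adjacency and equality together contribute at most 1 to each ordered pair.
Q-complete : ∀ {G} → Simple G → ∀ s → Q G (χ s) + sum (χ s) ≤ sum (χ s) * sum (χ s)
Q-complete {G} (_ , adj-irrefl) s = begin
  Q G x + sum x                                ≡⟨ ∑-distrib-+ {p} (λ i → x i * deg G x i) x ⟨
  ∑[ i < p ] (x i * deg G x i + x i)           ≤⟨ sum-mono {p} row ⟩
  ∑[ i < p ] (x i * sum x)                     ≡⟨ *-distribʳ-sum {p} (sum x) x ⟨
  sum x * sum x                                ∎
  where
  open ≤-Reasoning
  p = order G
  x = χ s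
  others : ∀ i j → a G i j + ≟-ind i j ≤ 1
  others i j with i ≟ᶠ j
  ... | yes refl rewrite adj-irrefl i = ≤-refl
  ... | no  _    = ≤-trans (≤-reflexive (+-identityʳ (a G i j))) (⟦⟧≤1 (adj G i j))
  neighbours : ∀ i → deg G x i + x i ≤ sum x
  neighbours i = begin
    deg G x i + x i                                             ≡⟨ cong (deg G x i +_) (sum-≟ i x) ⟨
    deg G x i + ∑[ j < p ] (≟-ind i j * x j)                    ≡⟨ ∑-distrib-+ {p} (λ j → a G i j * x j) (λ j → ≟-ind i j * x j) ⟨
    ∑[ j < p ] (a G i j * x j + ≟-ind i j * x j)                ≤⟨ sum-mono {p} (λ j → ≤-trans (≤-reflexive (sym (*-distribʳ-+ (x j) (a G i j) (≟-ind i j))))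
                                                                     (≤-trans (*-monoˡ-≤ (x j) (others i j)) (≤-reflexive (*-identityˡ (x j))))) ⟩
    sum x                                                       ∎
  row : ∀ i → x i * deg G x i + x i ≤ x i * sum x
  row i with s i | neighbours i
  ... | false | _ = z≤n
  ... | true  | h = ≤-trans (≤-reflexive (cong (_+ 1) (+-identityʳ (deg G x i)))) (≤-trans h (≤-reflexive (sym (+-identityʳ (sum x)))))

module Increments {G : Graph} (simple : Simple G) (C : Nest G) where

  open Nest C

  p : ℕ
  p = order G

  δ : ℕ → ℕ
  δ i = δᴳ G (suc i)

  open Lex p δ public

  I-complete : ∀ {k} → k ≤ p → 2 * I G k + k ≤ k * k
  I-complete {k} k≤p = subst₂ (λ x y → x + y ≤ y * y) (best k≤p) (size k≤p) (Q-complete {G} simple (set k))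

  I-mono : ∀ {k} → suc k ≤ p → I G k ≤ I G (suc k)
  I-mono {k} k<p = *-cancelˡ-≤ 2 (≤-trans (≤-reflexive (sym (best (<⇒≤ k<p))))
    (≤-trans (Q-mono G (grow (n≤1+n k))) (≤-reflexive (best k<p))))

  J≡I : ∀ {k} → k ≤ p → J k ≡ I G k
  J≡I {zero}  z≤n = sym (n≤0⇒n≡0 (*-cancelˡ-≤ 2 (≤-trans (m≤m+n (2 * I G 0) 0) (I-complete z≤n))))
  J≡I {suc k} k<p = trans (S-last k δ) (trans (cong (_+ δ k) (J≡I (<⇒≤ k<p))) (m+[n∸m]≡n (I-mono k<p)))

  I1≡0 : 1 ≤ p → I G 1 ≡ 0
  I1≡0 1≤p = n≤0⇒n≡0 (*-cancelˡ-≤ 2 (+-cancelʳ-≤ 1 (2 * I G 1) 0 (I-complete 1≤p)))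

  δ0 : 1 ≤ p → δ 0 ≡ 0
  δ0 1≤p = trans (cong (_∸ I G 0) (I1≡0 1≤p)) (0∸n≡0 (I G 0))

  δ1 : 2 ≤ p → δ 1 ≤ 1
  δ1 2≤p = ≤-trans (m∸n≤m (I G 2) (I G 1)) (*-cancelˡ-≤ 2 (+-cancelʳ-≤ 2 (2 * I G 2) 2 (I-complete 2≤p)))

  -- Adding an outside vertex `i` to the optimal set of size `k` gives `I G k + deg G x i` edges, at
  -- most `I G (suc k)`. Here `≟-ind i` is the indicator of the added vertex.
  deg≤δ : ∀ {k} → suc k ≤ p → ∀ i → set k i ≡ false → deg G (χ (set k)) i ≤ δ k
  deg≤δ {k} k<p i i∉ = m+n≤o⇒n≤o∸m (I G k) (*-cancelˡ-≤ 2 (begin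
    2 * (I G k + deg G x i)                  ≡⟨ *-distribˡ-+ 2 (I G k) (deg G x i) ⟩
    2 * I G k + 2 * deg G x i                ≡⟨ cong₂ (λ u v → u + 2 * v) (best (<⇒≤ k<p)) (sum-≟ i (deg G x)) ⟨
    Q G x + 2 * B G (≟-ind i) x              ≤⟨ m≤m+n _ (Q G (≟-ind i)) ⟩
    Q G x + 2 * B G (≟-ind i) x + Q G (≟-ind i) ≡⟨ Q-+ {G} simple x (≟-ind i) ⟨
    Q G (λ j → x j + ≟-ind i j)              ≡⟨ Q-cong G added ⟨
    Q G (χ s)                                ≤⟨ Q≤I {G} simple s total ⟩
    2 * I G (suc k)                          ∎))
    where
    open ≤-Reasoning
    x = χ (set k)
    s : Fin p → Bool
    s j = set k j ∨ ⌊ i ≟ᶠ j ⌋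
    added : ∀ j → χ s j ≡ x j + ≟-ind i j
    added j with i ≟ᶠ j
    ... | yes refl rewrite i∉ = refl
    ... | no  _ with set k j
    ...   | true  = refl
    ...   | false = refl
    m+n≤o⇒n≤o∸m : ∀ m {n o} → m + n ≤ o → n ≤ o ∸ m
    m+n≤o⇒n≤o∸m m {n} {o} h = ≤-trans (≤-reflexive (sym (m+n∸m≡n m n))) (∸-monoˡ-≤ m h)
    total : sum (χ s) ≡ suc k
    total = trans (sum-cong-≗ {p} added) (trans (∑-distrib-+ {p} x (≟-ind i))
      (trans (cong₂ _+_ (size (<⇒≤ k<p)) (trans (sum-cong-≗ {p} (λ j → sym (*-identityʳ (≟-ind i j)))) (sum-≟ i (λ _ → 1)))) (+-comm k 1)))

  -- Count the edges of the optimal set of size k + j through its optimal subset of size k.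
  window : ∀ k j → k < p → k + j ≤ p → S j (λ i → δ (k + i)) ≤ j * δ k + J j
  window k j k<p k+j≤p = +-cancelˡ-≤ (J k) _ _ (begin
    J k + S j (λ i → δ (k + i))     ≡⟨ S-split k j δ ⟨
    J (k + j)                       ≡⟨ J≡I k+j≤p ⟩
    I G (k + j)                     ≤⟨ *-cancelˡ-≤ 2 twice ⟩
    I G k + (j * δ k + I G j)       ≡⟨ cong₂ (λ u v → u + (j * δ k + v)) (J≡I (<⇒≤ k<p)) (J≡I j≤p) ⟨
    J k + (j * δ k + J j)           ∎)
    where
    open ≤-Reasoning
    j≤p : j ≤ p
    j≤p = ≤-trans (m≤n+m j k) k+j≤p
    x = χ (set k)
    r : Fin p → Bool
    r i = set (k + j) i ∧ not (set k i)
    parts : ∀ i → χ (set (k + j)) i ≡ x i + χ r i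
    parts i with set k i | set (k + j) i | grow (m≤m+n k j) i
    ... | true  | true  | _ = refl
    ... | true  | false | ()
    ... | false | true  | _ = refl
    ... | false | false | _ = refl
    size-r : sum (χ r) ≡ j
    size-r = +-cancelˡ-≡ k _ _ (begin-equality
      k + sum (χ r)                      ≡⟨ cong (_+ sum (χ r)) (size (<⇒≤ k<p)) ⟨
      sum x + sum (χ r)                  ≡⟨ ∑-distrib-+ {p} x (χ r) ⟨
      ∑[ i < p ] (x i + χ r i)           ≡⟨ sum-cong-≗ {p} parts ⟨
      sum (χ (set (k + j)))              ≡⟨ size k+j≤p ⟩
      k + j                              ∎)
    -- By `deg≤δ` each of the `j` new vertices has at most `δ k` neighbours in the smaller set.
    cross : B G (χ r) x ≤ j * δ k
    cross = begin
      B G (χ r) x                        ≤⟨ sum-mono {p} each ⟩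
      ∑[ i < p ] (χ r i * δ k)           ≡⟨ *-distribʳ-sum {p} (δ k) (χ r) ⟨
      sum (χ r) * δ k                    ≡⟨ cong (_* δ k) size-r ⟩
      j * δ k                            ∎
      where
      each : ∀ i → χ r i * deg G x i ≤ χ r i * δ k
      each i with set (k + j) i | set k i in eq
      ... | false | _     = z≤n
      ... | true  | true  = z≤n
      ... | true  | false = +-monoˡ-≤ 0 (deg≤δ k<p i eq)
    twice : 2 * I G (k + j) ≤ 2 * (I G k + (j * δ k + I G j))
    twice = begin
      2 * I G (k + j)                              ≡⟨ best k+j≤p ⟨
      Q G (χ (set (k + j)))                        ≡⟨ Q-cong G parts ⟩
      Q G (λ i → x i + χ r i)                      ≡⟨ Q-+ {G} simple x (χ r) ⟩
      Q G x + 2 * B G (χ r) x + Q G (χ r)          ≤⟨ +-mono-≤ (+-mono-≤ (≤-reflexive (best (<⇒≤ k<p))) (*-monoʳ-≤ 2 cross)) (Q≤I {G} simple r size-r) ⟩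
      2 * I G k + 2 * (j * δ k) + 2 * I G j        ≡⟨ regroup (I G k) (j * δ k) (I G j) ⟩
      2 * (I G k + (j * δ k + I G j))              ∎
      where
      regroup : ∀ a b c → 2 * a + 2 * b + 2 * c ≡ 2 * (a + (b + c))
      regroup = solve-∀

  -- The position of a vertex in the order in which it enters the nested sets.
  rank : Fin p → ℕ
  rank y = S p (λ k → 1 ∸ χ (set (suc k)) y)

  -- The chain increases, so `y` is missing from an initial run of the sets, and `rank y` is the
  -- length of that run by `lt-count`.
  set-rank : ∀ {k} → k ≤ p → ∀ y → χ (set k) y ≡ lt (rank y) k
  set-rank {zero}  k≤p y = n≤0⇒n≡0 (≤-trans (term≤sum (χ (set 0)) y) (≤-reflexive (size z≤n)))
  set-rank {suc k} k<p y = +-cancelʳ-≡ (lt k (rank y)) _ _ (trans here′ (sym (lt-flip (rank y) k)))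
    where
    here′ : χ (set (suc k)) y + lt k (rank y) ≡ 1
    here′ = trans (cong (χ (set (suc k)) y +_) (lt-count p (λ i≤j → ∸-monoʳ-≤ 1 (grow (s≤s i≤j) y)) (λ i → m∸n≤m 1 (χ (set (suc i)) y)) k<p))
                  (m+[n∸m]≡n (⟦⟧≤1 (set (suc k) y)))

  rank≤ : ∀ y → rank y ≤ p
  rank≤ y = ≤-trans (sum≤* {p} {1} (λ i → m∸n≤m 1 (χ (set (suc (toℕ i))) y))) (≤-reflexive (*-identityʳ p))

  rank<p : ∀ y → rank y < p
  rank<p y = ≰⇒> λ p≤rank → contradiction (trans (sym full) (trans (set-rank ≤-refl y) (lt≡0 p≤rank))) λ ()
    where
    full : χ (set p) y ≡ 1
    full = sum-tight {p} {χ (set p)} {λ _ → 1} (λ i → ⟦⟧≤1 (set p i)) (trans (size ≤-refl) (sym (S-ones p))) y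

  -- `rank` is a bijection onto the numbers below `p`, expressed through level counts: the vertices
  -- of rank at most `h` form the set of size `suc h`.
  sum-rank : ∀ (Φ : ℕ → ℕ) → ∑[ y < p ] Φ (rank y) ≡ S p Φ
  sum-rank = equidistributed {p} {p} {rank} {toℕ} rank≤ (λ y → <⇒≤ (toℕ<n y)) level
    where
    below : ∀ (u : Fin p → ℕ) h → τ u h + ∑[ y < p ] lt (u y) (suc h) ≡ p
    below u h = trans (sym (∑-distrib-+ {p} (λ y → lt h (u y)) (λ y → lt (u y) (suc h))))
      (trans (sum-cong-≗ {p} (λ y → trans (+-comm (lt h (u y)) _) (lt-flip (u y) h))) (S-ones p))
    level : ∀ h → τ rank h ≡ τ {p} toℕ h
    level h with h <? p
    ... | no  h≮p = trans (τ≡0 {p} rank≤ (≮⇒≥ h≮p)) (sym (τ≡0 {p} (λ y → <⇒≤ (toℕ<n y)) (≮⇒≥ h≮p)))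
    ... | yes h<p = +-cancelʳ-≡ (suc h) _ _ (trans (same rank count-rank) (sym (same toℕ (S-lt p h<p))))
      where
      same : ∀ u → ∑[ y < p ] lt (u y) (suc h) ≡ suc h → τ u h + suc h ≡ p
      same u e = trans (cong (τ u h +_) (sym e)) (below u h)
      count-rank : ∑[ y < p ] lt (rank y) (suc h) ≡ suc h
      count-rank = trans (sum-cong-≗ {p} (λ y → sym (set-rank h<p y))) (size h<p)

-- Products

pair-adj : (H G : Graph) → (c d : Fin (order H) × Fin (order G)) → Bool
pair-adj H G (x , y) (u , v) = (⌊ x ≟ᶠ u ⌋ ∧ adj G y v) ∨ (adj H x u ∧ ⌊ y ≟ᶠ v ⌋)

□-simple : ∀ {H G} → Simple H → Simple G → Simple (H □ G)
□-simple {H} {G} (symH , irrH) (symG , irrG) =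
    (λ c d → pair-sym (remQuot {order H} (order G) c) (remQuot {order H} (order G) d))
  , (λ c → pair-irr (remQuot {order H} (order G) c))
  where
  ⌊≟⌋-comm : ∀ {n} (i j : Fin n) → ⌊ i ≟ᶠ j ⌋ ≡ ⌊ j ≟ᶠ i ⌋
  ⌊≟⌋-comm i j with i ≟ᶠ j | j ≟ᶠ i
  ... | yes _ | yes _ = refl
  ... | no  _ | no  _ = refl
  ... | yes p | no  q = contradiction (sym p) q
  ... | no  p | yes q = contradiction (sym q) p
  pair-sym : ∀ c d → pair-adj H G c d ≡ pair-adj H G d c
  pair-sym (x , y) (u , v) = cong₂ _∨_ (cong₂ _∧_ (⌊≟⌋-comm x u) (symG y v)) (cong₂ _∧_ (symH x u) (⌊≟⌋-comm y v))
  pair-irr : ∀ c → pair-adj H G c c ≡ false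
  pair-irr (x , y) = trans
    (cong₂ (λ b b′ → (⌊ x ≟ᶠ x ⌋ ∧ b) ∨ (b′ ∧ ⌊ y ≟ᶠ y ⌋)) (irrG y) (irrH x))
    (cong (_∨ false) (∧-zeroʳ ⌊ x ≟ᶠ x ⌋))

-- The two kinds of product edges exclude each other because `G` has no loops, so the disjunction
-- becomes a sum.
□-adj : ∀ {H G} → Simple G → ∀ x y u v → a (H □ G) (combine x y) (combine u v) ≡
        ≟-ind x u * a G y v + a H x u * ≟-ind y v
□-adj {H} {G} (_ , irrG) x y u v =
  trans (cong₂ (λ c d → ⟦ pair-adj H G c d ⟧) (remQuot-combine x y) (remQuot-combine u v)) cases
  where
  cases : ⟦ pair-adj H G (x , y) (u , v) ⟧ ≡ ≟-ind x u * a G y v + a H x u * ≟-ind y v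
  cases with y ≟ᶠ v
  ... | yes refl rewrite irrG y | ∧-zeroʳ ⌊ x ≟ᶠ u ⌋ | *-zeroʳ (≟-ind x u) = ⟦∧⟧ (adj H x u) true
  ... | no  _    rewrite ∧-zeroʳ (adj H x u) | *-zeroʳ (a H x u) | ∨-identityʳ (⌊ x ≟ᶠ u ⌋ ∧ adj G y v) =
    trans (⟦∧⟧ ⌊ x ≟ᶠ u ⌋ (adj G y v)) (sym (+-identityʳ _))

module _ {H G : Graph} (simple : Simple G) where
  private
    N = order H
    p = order G

  □-deg : ∀ z x y → deg (H □ G) z (combine x y) ≡
          deg G (λ v → z (combine x v)) y + deg H (λ u → z (combine u y)) x
  □-deg z x y = begin
    deg (H □ G) z (combine x y)
      ≡⟨ sum-combine N p (λ c → a (H □ G) (combine x y) c * z c) ⟩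
    ∑[ u < N ] ∑[ v < p ] (a (H □ G) (combine x y) (combine u v) * Z u v)
      ≡⟨ sum-cong₂ {N} {p} (λ u v → trans (cong (_* Z u v) (□-adj {H} {G} simple x y u v))
           (regroup (≟-ind x u) (a G y v) (a H x u) (≟-ind y v) (Z u v))) ⟩
    ∑[ u < N ] ∑[ v < p ] (≟-ind x u * (a G y v * Z u v) + a H x u * (≟-ind y v * Z u v))
      ≡⟨ sum-cong-≗ {N} (λ u → trans (∑-distrib-+ {p} (λ v → ≟-ind x u * (a G y v * Z u v)) (λ v → a H x u * (≟-ind y v * Z u v)))
           (cong₂ _+_ (sym (*-distribˡ-sum {p} (≟-ind x u) (λ v → a G y v * Z u v)))
             (trans (sym (*-distribˡ-sum {p} (a H x u) (λ v → ≟-ind y v * Z u v))) (cong (a H x u *_) (sum-≟ y (Z u)))))) ⟩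
    ∑[ u < N ] (≟-ind x u * deg G (Z u) y + a H x u * Z u y)
      ≡⟨ ∑-distrib-+ {N} (λ u → ≟-ind x u * deg G (Z u) y) (λ u → a H x u * Z u y) ⟩
    ∑[ u < N ] (≟-ind x u * deg G (Z u) y) + deg H (λ u → Z u y) x
      ≡⟨ cong (_+ deg H (λ u → Z u y) x) (sum-≟ x (λ u → deg G (Z u) y)) ⟩
    deg G (Z x) y + deg H (λ u → Z u y) x ∎
    where
    open ≡-Reasoning
    Z : Fin N → Fin p → ℕ
    Z u v = z (combine u v)
    regroup : ∀ i g h j z → (i * g + h * j) * z ≡ i * (g * z) + h * (j * z)
    regroup = solve-∀

  □-Q : ∀ z → Q (H □ G) z ≡ ∑[ y < p ] Q H (λ x → z (combine x y)) + ∑[ x < N ] Q G (λ y → z (combine x y))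
  □-Q z = begin
    Q (H □ G) z
      ≡⟨ sum-combine N p (λ c → z c * deg (H □ G) z c) ⟩
    ∑[ x < N ] ∑[ y < p ] (Z x y * deg (H □ G) z (combine x y))
      ≡⟨ sum-cong-≗ {N} (λ x → trans (sum-cong-≗ {p} (λ y → trans (cong (Z x y *_) (□-deg z x y)) (*-distribˡ-+ (Z x y) (deg G (Z x) y) (deg H (λ u → Z u y) x))))
           (∑-distrib-+ {p} (λ y → Z x y * deg G (Z x) y) (λ y → Z x y * deg H (λ u → Z u y) x))) ⟩
    ∑[ x < N ] (Q G (Z x) + ∑[ y < p ] (Z x y * deg H (λ u → Z u y) x))
      ≡⟨ ∑-distrib-+ {N} (λ x → Q G (Z x)) (λ x → ∑[ y < p ] (Z x y * deg H (λ u → Z u y) x)) ⟩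
    ∑[ x < N ] Q G (Z x) + ∑[ x < N ] ∑[ y < p ] (Z x y * deg H (λ u → Z u y) x)
      ≡⟨ cong (∑[ x < N ] Q G (Z x) +_) (∑-comm {N} {p} (λ x y → Z x y * deg H (λ u → Z u y) x)) ⟩
    ∑[ x < N ] Q G (Z x) + ∑[ y < p ] Q H (λ x → Z x y)
      ≡⟨ +-comm (∑[ x < N ] Q G (Z x)) _ ⟩
    ∑[ y < p ] Q H (λ x → Z x y) + ∑[ x < N ] Q G (Z x) ∎
    where
    open ≡-Reasoning
    Z : Fin N → Fin p → ℕ
    Z u v = z (combine u v)

lt-* : ∀ h x y → lt h x * lt h y ≡ lt h (x ⊓ y)
lt-* h       zero    y       = refl
lt-* h       (suc x) zero    = *-zeroʳ (lt h (suc x))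
lt-* zero    (suc x) (suc y) = refl
lt-* (suc h) (suc x) (suc y) = lt-* h x y

module Product {H G : Graph} (simpleH : Simple H) (simpleG : Simple G) (nestH : Nest H) (nestG : Nest G) where

  open Increments {G} simpleG nestG
  private
    N = order H
    module ℋ = Nest nestH
    module 𝒢 = Nest nestG

  simple□ : Simple (H □ G)
  simple□ = □-simple {H} {G} simpleH simpleG

  columns : (Fin (N * p) → Bool) → Fin p → ℕ
  columns s y = ∑[ x < N ] χ s (combine x y)

  columns≤ : ∀ s y → columns s y ≤ N
  columns≤ s y = ≤-trans (sum≤* {N} {1} (λ x → ⟦⟧≤1 (s (combine x y)))) (≤-reflexive (*-identityʳ N))

  sum-columns : ∀ s → sum (columns s) ≡ sum (χ s)
  sum-columns s = trans (∑-comm {p} {N} (λ y x → χ s (combine x y))) (sym (sum-combine N p (χ s)))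

  -- Two columns of heights f y and f v share at most f y ⊓ f v rows; the level sets of f realise this minimum.
  rows-≤ : ∀ s → ∑[ x < N ] Q G (λ y → χ s (combine x y)) ≤ S N (λ h → Q G (λ y → lt h (columns s y)))
  rows-≤ s = begin
    ∑[ x < N ] Q G (Z x)                                              ≡⟨ pairs N Z ⟩
    ∑[ y < p ] ∑[ v < p ] (a G y v * ∑[ x < N ] (Z x y * Z x v))
      ≤⟨ sum-mono {p} (λ y → sum-mono {p} (λ v → *-monoʳ-≤ (a G y v) (common y v))) ⟩
    ∑[ y < p ] ∑[ v < p ] (a G y v * ∑[ h < N ] (lt (toℕ h) (f y) * lt (toℕ h) (f v)))
                                                                      ≡⟨ pairs N (λ h y → lt (toℕ h) (f y)) ⟨
    S N (λ h → Q G (λ y → lt h (f y)))                                ∎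
    where
    open ≤-Reasoning
    f = columns s
    Z : Fin N → Fin p → ℕ
    Z x y = χ s (combine x y)
    pairs : ∀ m (Y : Fin m → Fin p → ℕ) →
      ∑[ x < m ] Q G (Y x) ≡ ∑[ y < p ] ∑[ v < p ] (a G y v * ∑[ x < m ] (Y x y * Y x v))
    pairs m Y = begin-equality
      ∑[ x < m ] Q G (Y x)                                              ≡⟨ sum-cong-≗ {m} (λ x → Q-terms G (Y x) (Y x)) ⟩
      ∑[ x < m ] ∑[ y < p ] ∑[ v < p ] (Y x y * (a G y v * Y x v))      ≡⟨ ∑-comm {m} {p} (λ x y → ∑[ v < p ] (Y x y * (a G y v * Y x v))) ⟩
      ∑[ y < p ] ∑[ x < m ] ∑[ v < p ] (Y x y * (a G y v * Y x v))      ≡⟨ sum-cong-≗ {p} (λ y → ∑-comm {m} {p} (λ x v → Y x y * (a G y v * Y x v))) ⟩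
      ∑[ y < p ] ∑[ v < p ] ∑[ x < m ] (Y x y * (a G y v * Y x v))      ≡⟨ sum-cong₂ {p} {p} (λ y v → trans
          (sum-cong-≗ {m} (λ x → regroup (Y x y) (a G y v) (Y x v))) (sym (*-distribˡ-sum {m} (a G y v) (λ x → Y x y * Y x v)))) ⟩
      ∑[ y < p ] ∑[ v < p ] (a G y v * ∑[ x < m ] (Y x y * Y x v))      ∎
      where
      regroup : ∀ x y z → x * (y * z) ≡ y * (x * z)
      regroup = solve-∀
    common : ∀ y v → ∑[ x < N ] (Z x y * Z x v) ≤ ∑[ h < N ] (lt (toℕ h) (f y) * lt (toℕ h) (f v))
    common y v = begin
      ∑[ x < N ] (Z x y * Z x v)      ≤⟨ ⊓-glb (sum-mono {N} (λ x → ≤-trans (*-monoʳ-≤ (Z x y) (⟦⟧≤1 (s (combine x v)))) (≤-reflexive (*-identityʳ (Z x y)))))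
                                               (sum-mono {N} (λ x → ≤-trans (*-monoˡ-≤ (Z x v) (⟦⟧≤1 (s (combine x y)))) (≤-reflexive (*-identityˡ (Z x v))))) ⟩
      f y ⊓ f v                       ≡⟨ S-lt N (≤-trans (m⊓n≤m (f y) (f v)) (columns≤ s y)) ⟨
      S N (λ h → lt h (f y ⊓ f v))    ≡⟨ S-cong {N} (λ h _ → lt-* h (f y) (f v)) ⟨
      ∑[ h < N ] (lt (toℕ h) (f y) * lt (toℕ h) (f v)) ∎

  compress : (Fin (N * p) → Bool) → ℕ → ℕ
  compress s = srt {p} N (columns s)

  compress-total : ∀ s → S p (compress s) ≡ sum (χ s)
  compress-total s = trans (S-srt {p} {N} {columns s} (columns≤ s)) (sum-columns s)

  -- Each copy of `H` has at most `I H` of its size many edges. For the copies of `G`, `rows-≤`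
  -- passes to the level sets of the column sizes, each bounded by `J`, and layer-cake summation
  -- turns these bounds into the weights `δ a`.
  compress-≤ : ∀ s → Q (H □ G) (χ s) ≤ 2 * colval (I H) (compress s)
  compress-≤ s = begin
    Q (H □ G) (χ s)
      ≡⟨ □-Q {H} {G} simpleG (χ s) ⟩
    ∑[ y < p ] Q H (λ x → χ s (combine x y)) + ∑[ x < N ] Q G (λ y → χ s (combine x y))
      ≤⟨ +-mono-≤ (sum-mono {p} (λ y → Q≤I {H} simpleH (λ x → s (combine x y)) refl)) (rows-≤ s) ⟩
    ∑[ y < p ] (2 * I H (f y)) + S N (λ h → Q G (λ y → lt h (f y)))
      ≤⟨ +-monoʳ-≤ (∑[ y < p ] (2 * I H (f y))) (S-mono {N} (λ h _ → ≤-trans (Q≤I {G} simpleG (λ y → h <ᵇ f y) refl)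
           (≤-reflexive (cong (2 *_) (sym (J≡I (τ≤ {p} f h))))))) ⟩
    ∑[ y < p ] (2 * I H (f y)) + S N (λ h → 2 * J (τ {p} f h))
      ≡⟨ cong₂ _+_ (sym (*-distribˡ-sum {p} 2 (λ y → I H (f y)))) (sym (*-distribˡ-sum {N} 2 (λ h → J (τ {p} f (toℕ h))))) ⟩
    2 * sum {p} (λ y → I H (f y)) + 2 * S N (λ h → J (τ {p} f h))
      ≡⟨ cong₂ (λ u v → 2 * u + 2 * v) (sum-srt {p} {N} {f} (columns≤ s) (I H)) (S-τ {N} {p} {τ {p} f ∘ toℕ} (λ h → τ≤ {p} f (toℕ h)) δ) ⟨
    2 * S p (I H ∘ compress s) + 2 * S p (λ a → δ a * compress s a)
      ≡⟨ *-distribˡ-+ 2 (S p (I H ∘ compress s)) _ ⟨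
    2 * (S p (I H ∘ compress s) + S p (λ a → δ a * compress s a))
      ≡⟨ cong (2 *_) (∑-distrib-+ {p} (λ a → I H (compress s (toℕ a))) (λ a → δ (toℕ a) * compress s (toℕ a))) ⟨
    2 * colval (I H) (compress s) ∎
    where
    open ≤-Reasoning
    f = columns s

  stack : (ℕ → ℕ) → Fin (N * p) → Bool
  stack f c = ℋ.set (f (rank (proj₂ (remQuot {N} p c)))) (proj₁ (remQuot {N} p c))

  χ-stack : ∀ f x y → χ (stack f) (combine x y) ≡ χ (ℋ.set (f (rank y))) x
  χ-stack f x y = cong (λ c → χ (ℋ.set (f (rank (proj₂ c)))) (proj₁ c)) (remQuot-combine {N} {p} x y)

  stack-size : ∀ {f} → (∀ a → f a ≤ N) → sum (χ (stack f)) ≡ S p f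
  stack-size {f} f≤N = begin
    sum (χ (stack f))                                         ≡⟨ sum-columns (stack f) ⟨
    ∑[ y < p ] ∑[ x < N ] χ (stack f) (combine x y)           ≡⟨ sum-cong-≗ {p} (λ y → trans (sum-cong-≗ {N} (λ x → χ-stack f x y)) (ℋ.size (f≤N (rank y)))) ⟩
    ∑[ y < p ] f (rank y)                                     ≡⟨ sum-rank f ⟩
    S p f                                                     ∎
    where open ≡-Reasoning

  -- The sets in `H` are nested and `f` is antitone, so row `x` consists of the first `k x` vertices
  -- of `G` in rank order. It is an optimal set of `G`, and no bound used in compression loses
  -- anything.
  stack-value : ∀ {f} → Antitone f → (∀ a → f a ≤ N) → Q (H □ G) (χ (stack f)) ≡ 2 * colval (I H) f
  stack-value {f} anti f≤N = begin
    Q (H □ G) (χ (stack f))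
      ≡⟨ □-Q {H} {G} simpleG (χ (stack f)) ⟩
    ∑[ y < p ] Q H (λ x → χ (stack f) (combine x y)) + ∑[ x < N ] Q G (λ y → χ (stack f) (combine x y))
      ≡⟨ cong₂ _+_ (sum-cong-≗ {p} (λ y → trans (Q-cong H (λ x → χ-stack f x y)) (ℋ.best (f≤N (rank y)))))
                   (sum-cong-≗ {N} row) ⟩
    ∑[ y < p ] (2 * I H (f (rank y))) + ∑[ x < N ] (2 * S p (λ a → δ a * t x a))
      ≡⟨ cong₂ _+_ (sym (*-distribˡ-sum {p} 2 (λ y → I H (f (rank y))))) (sym (*-distribˡ-sum {N} 2 (λ x → S p (λ a → δ a * t x a)))) ⟩
    2 * sum {p} (λ y → I H (f (rank y))) + 2 * sum {N} (λ x → S p (λ a → δ a * t x a))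
      ≡⟨ cong₂ (λ u v → 2 * u + 2 * v) (sum-rank (I H ∘ f)) weights ⟩
    2 * S p (I H ∘ f) + 2 * S p (λ a → δ a * f a)
      ≡⟨ *-distribˡ-+ 2 (S p (I H ∘ f)) _ ⟨
    2 * (S p (I H ∘ f) + S p (λ a → δ a * f a))
      ≡⟨ cong (2 *_) (∑-distrib-+ {p} (λ a → I H (f (toℕ a))) (λ a → δ (toℕ a) * f (toℕ a))) ⟨
    2 * colval (I H) f ∎
    where
    open ≡-Reasoning
    t : Fin N → ℕ → ℕ
    t x a = χ (ℋ.set (f a)) x
    t≤1 : ∀ x a → t x a ≤ 1
    t≤1 x a = ⟦⟧≤1 (ℋ.set (f a) x)
    k : Fin N → ℕ
    k x = S p (t x)
    k≤p : ∀ x → k x ≤ p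
    k≤p x = ≤-trans (sum≤* {p} {1} (λ a → t≤1 x (toℕ a))) (≤-reflexive (*-identityʳ p))
    lt-k : ∀ x {a} → a < p → lt a (k x) ≡ t x a
    lt-k x = lt-count p {t x} (λ a≤b → ℋ.grow (anti a≤b) x) (t≤1 x)
    row : ∀ x → Q G (λ y → χ (stack f) (combine x y)) ≡ 2 * S p (λ a → δ a * t x a)
    row x = begin
      Q G (λ y → χ (stack f) (combine x y))  ≡⟨ Q-cong G (λ y → trans (χ-stack f x y) (trans (sym (lt-k x (rank<p y))) (sym (set-rank (k≤p x) y)))) ⟩
      Q G (χ (𝒢.set (k x)))                  ≡⟨ 𝒢.best (k≤p x) ⟩
      2 * I G (k x)                          ≡⟨ cong (2 *_) (J≡I (k≤p x)) ⟨
      2 * J (k x)                            ≡⟨ cong (2 *_) (S-*lt p δ (k≤p x)) ⟨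
      2 * S p (λ a → δ a * lt a (k x))       ≡⟨ cong (2 *_) (S-cong {p} (λ a a<p → cong (δ a *_) (lt-k x a<p))) ⟩
      2 * S p (λ a → δ a * t x a)            ∎
    weights : sum {N} (λ x → S p (λ a → δ a * t x a)) ≡ S p (λ a → δ a * f a)
    weights = trans (∑-comm {N} {p} (λ x a → δ (toℕ a) * t x (toℕ a)))
      (S-cong {p} (λ a _ → trans (sym (*-distribˡ-sum {N} (δ a) (λ x → t x a))) (cong (δ a *_) (ℋ.size (f≤N a)))))

  stack-≤ : ∀ {f} → Antitone f → (∀ a → f a ≤ N) → colval (I H) f ≤ I (H □ G) (S p f)
  stack-≤ {f} anti f≤N = *-cancelˡ-≤ 2 (≤-trans (≤-reflexive (sym (stack-value anti f≤N)))
    (Q≤I {H □ G} simple□ (stack f) (stack-size f≤N)))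

  -- The stacks over `fill N m` increase with `m`. Compressing an arbitrary set of size `m` and
  -- applying `opt` shows that none has more edges.
  product-nested : OPT (I H) N →
    NestedSolutions (H □ G) × (∀ {m} → m ≤ N * p → I (H □ G) m ≡ L (I H) N m)
  product-nested opt = unnest {H □ G} simple□ (λ m → stack (fill N m)) (L (I H) N)
    (λ {m} m≤ → trans (stack-size (fill≤ N m)) (S-fill {N} p (≤-trans m≤ (≤-reflexive (*-comm N p)))))
    (λ m → stack-value (fill-antitone N m) (fill≤ N m))
    (λ {m} _ → I≤ (H □ G) {m} (λ A eq → *-cancelˡ-≤ 2 (begin
      2 * edgesIn (H □ G) A                         ≡⟨ edgesIn-Q {H □ G} simple□ A ⟩
      Q (H □ G) (χ (lookup A))                      ≤⟨ compress-≤ (lookup A) ⟩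
      2 * colval (I H) (compress (lookup A))        ≤⟨ *-monoʳ-≤ 2 (opt _ (srt-antitone {p} N (columns (lookup A))) (srt≤ {p} N (columns (lookup A)))) ⟩
      2 * L (I H) N (S p (compress (lookup A)))     ≡⟨ cong (λ k → 2 * L (I H) N k) (trans (compress-total (lookup A)) (trans (sym (∣∣-sum A)) eq)) ⟩
      2 * L (I H) N m                               ∎)))
    (λ m c → ℋ.grow (fill-mono N (n≤1+n m) (rank (proj₂ (remQuot {N} p c)))) (proj₁ (remQuot {N} p c)))
    where open ≤-Reasoning

-- The induction on the exponent

OPT-cong : ∀ {p δ F F′ N} → (∀ {k} → k ≤ N → F k ≡ F′ k) → Lex.OPT p δ F N → Lex.OPT p δ F′ N
OPT-cong {p} {δ} {F} {F′} {N} e opt f anti f≤N = subst₂ _≤_ (same f f≤N) (same (fill N (S p f)) (fill≤ N (S p f))) (opt f anti f≤N)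
  where
  same : ∀ f → (∀ a → f a ≤ N) → Lex.colval p δ F f ≡ Lex.colval p δ F′ f
  same f f≤N = S-cong {p} (λ a _ → cong (_+ δ a * f a) (e (f≤N a)))

OPT-trivial : ∀ {p δ F N} → p < 2 → Lex.OPT p δ F N
OPT-trivial {zero}        _ f anti f≤N = z≤n
OPT-trivial {suc zero} {δ} {F} {N} _ f anti f≤N =
  ≤-reflexive (cong (λ x → F x + δ 0 * x + 0) (sym (trans (cong (N ⊓_) (+-identityʳ (f 0))) (m≥n⇒m⊓n≡n (f≤N 0)))))
OPT-trivial {suc (suc _)} (s≤s (s≤s ()))

-- The grid argument needs two columns; for smaller orders there is nothing to compare.
OPT-suc : ∀ p δ F N → Lex.OPT p δ F N → Lex.OPT p δ (Lex.J p δ) p → (1 ≤ p → δ 0 ≡ 0) →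
  (∀ k → suc k < p → δ (suc k) ≤ δ k + δ (p ∸ 1)) → Lex.OPT p δ (Lex.L p δ F N) (N * p)
OPT-suc zero          δ F N _    _    _  _     = OPT-trivial {0} {δ} {Lex.L 0 δ F N} {N * 0} (s≤s z≤n)
OPT-suc (suc zero)    δ F N _    _    _  _     = OPT-trivial {1} {δ} {Lex.L 1 δ F N} {N * 1} (s≤s (s≤s z≤n))
OPT-suc (suc (suc q)) δ F N optF optJ δ0 slope = Cells.OPT-step q δ F N optF optJ (δ0 (s≤s z≤n)) slope

module Powers {G : Graph} (simple : Simple G) (dense : DeltaDense G) (ns : NestedSolutions G) (ns² : NestedSolutions (G □ G)) where

  nestG : Nest G
  nestG = nest simple ns

  open Increments {G} simple nestG
  open Product {G} {G} simple simple nestG nestG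
  open Square p δ

  -- After the first position a value either exceeds its predecessor or starts a new segment, where
  -- density makes it at least 2. Hence `δ 1` is positive and all later values are at least 2.
  δ-suc-positive : ∀ b → suc b < p → 1 ≤ δ (suc b)
  δ-suc-suc-≥2 : ∀ b → 2 + b < p → 2 ≤ δ (2 + b)

  δ-suc-positive zero 1<p with 1 ≤? δ 1
  ... | yes h = h
  ... | no  h = ≤-trans (n≤1+n 1) (dense 2 ≤-refl 1<p (≤-trans (s≤s⁻¹ (≰⇒> h)) z≤n))
  δ-suc-positive (suc b) b<p = ≤-trans (n≤1+n 1) (δ-suc-suc-≥2 b b<p)

  δ-suc-suc-≥2 b b<p with δ (2 + b) ≤? δ (suc b)
  ... | yes h = dense (3 + b) (s≤s (s≤s z≤n)) b<p h
  ... | no  h = ≤-trans (s≤s (δ-suc-positive b (<-trans (n<1+n (suc b)) b<p))) (≰⇒> h)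

  δ-≥2 : ∀ {b} → 2 ≤ b → b < p → 2 ≤ δ b
  δ-≥2 {suc (suc b)} _        = δ-suc-suc-≥2 b
  δ-≥2 {suc zero}    (s≤s ()) _

  nestG² : Nest (G □ G)
  nestG² = nest {G □ G} simple□ ns²

  colval-J : ∀ {f} → (∀ a → f a ≤ p) → colval J f ≡ colval (I G) f
  colval-J {f} f≤p = S-cong {p} (λ a _ → cong (_+ δ a * f a) (J≡I (f≤p a)))

  compressed : ℕ → ℕ → ℕ
  compressed m = compress (Nest.set nestG² m)

  -- Compression is monotone in the set, so the chain survives. A staircase `g` is realised by a
  -- stack, whose edges cannot outnumber those of the optimal set, and compressing that set loses
  -- none.
  compressed-nested : NestedOptima compressed
  compressed-nested = record
    { antitone = λ m → srt-antitone {p} p (u m)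
    ; bounded  = λ m → srt≤ {p} p (u m)
    ; outside  = λ m → srt≡0 {p} p (u m)
    ; total    = λ {m} m≤ → trans (compress-total (set m)) (size m≤)
    ; nested   = λ {m} _ → τ-mono {p} (λ h → τ-mono {p} {u m} {u (suc m)} (λ y → sum-mono {p} (λ x → grow (n≤1+n m) (combine x y))) (toℕ h))
    ; optimal  = λ {m} m≤ g anti g≤p eq → *-cancelˡ-≤ 2 (begin
        2 * colval J g                      ≡⟨ cong (2 *_) (colval-J g≤p) ⟩
        2 * colval (I G) g                  ≤⟨ *-monoʳ-≤ 2 (stack-≤ anti g≤p) ⟩
        2 * I (G □ G) (S p g)               ≡⟨ cong (λ k → 2 * I (G □ G) k) eq ⟩
        2 * I (G □ G) m                     ≡⟨ best m≤ ⟨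
        Q (G □ G) (χ (set m))               ≤⟨ compress-≤ (set m) ⟩
        2 * colval (I G) (compressed m)     ≡⟨ cong (2 *_) (colval-J (srt≤ {p} p (u m))) ⟨
        2 * colval J (compressed m)         ∎)
    }
    where
    open ≤-Reasoning
    open Nest nestG²
    u : ℕ → Fin p → ℕ
    u m = columns (set m)

  lex-square : OPT J p
  lex-square with 2 ≤? p
  ... | no  h   = OPT-trivial {p} {δ} {J} {p} (≰⇒> h)
  ... | yes 2≤p = Lexicographic.lex-optimal 2≤p (δ0 (≤-trans (n≤1+n 1) 2≤p)) (δ1 2≤p) δ-≥2 window compressed-nested

  -- A step raises `δ` by at most 1, and density makes the last value `δ (p ∸ 1)` positive.
  slope : ∀ k → suc k < p → δ (suc k) ≤ δ k + δ (p ∸ 1)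
  slope k k<p = ≤-trans (Lexicographic.δ-suc 2≤p (δ0 (≤-trans (n≤1+n 1) 2≤p)) (δ1 2≤p) δ-≥2 window k<p)
    (+-monoʳ-≤ (δ k) (last-positive p 2≤p refl))
    where
    2≤p : 2 ≤ p
    2≤p = ≤-trans (s≤s (s≤s z≤n)) k<p
    -- The order of `G` is replaced by a variable `p′` so that it can be matched against
    -- `suc (suc q)`.
    last-positive : ∀ p′ → 2 ≤ p′ → p′ ≡ p → 1 ≤ δ (p′ ∸ 1)
    last-positive (suc (suc q)) _ eq = δ-suc-positive q (≤-reflexive eq)
    last-positive (suc zero) (s≤s ()) _

  -- The last component concerns the product `H □ G`, so the induction runs one power ahead: its
  -- base case is the statement about the square.
  LexOptimal : Graph → Set
  LexOptimal H = Simple H × NestedSolutions H × OPT (I H) (order H)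

  base : LexOptimal G
  base = simple , ns , OPT-cong {p} {δ} {J} {I G} {p} J≡I lex-square

  -- `opt` makes `H □ G` nested and gives its values `I` as `L (I H)`. For these values `OPT-suc`
  -- supplies the optimality in the product after that.
  step : ∀ {H} → LexOptimal H → LexOptimal (H □ G)
  step {H} (simpleH , nsH , opt) =
      □-simple {H} {G} simpleH simple
    , proj₁ result
    , OPT-cong {p} {δ} (λ k≤ → sym (proj₂ result k≤)) (OPT-suc p δ (I H) (order H) opt lex-square δ0 slope)
    where result = Product.product-nested {H} {G} simpleH simple (nest {H} simpleH nsH) nestG opt

  power : ∀ d → LexOptimal (G ^□ suc d)
  power zero    = base
  power (suc d) = step {G ^□ suc d} (power d)

theorem4 : (G : Graph) → Simple G → DeltaDense G →
    NestedSolutions G → NestedSolutions (G ^□ 2) →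
    ∀ (d : ℕ) → 3 ≤ d → NestedSolutions (G ^□ d)
theorem4 G simple dense ns ns² (suc d) _ = proj₁ (proj₂ (Powers.power simple dense ns ns² d))
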